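{- Let $\mathbb{F}_q$ be the finite field with $q$ elements and assume its characteristic is at least $3$. If $A$ is a multiplicative character of $\mathbb{F}_q^\times$, then for all $x\in\mathbb{F}_q$, $${}_2\mathbb{F}_1\!\left(A,\overline{A};\phi;\tfrac{27x(1-x)^2}{4}\right)={}_2\mathbb{F}_1\!\left(A^3,\overline{A^3};\phi;\tfrac{3x}{4}\right)-\phi(-3)\,\delta(x-1)-\phi(-3)A(-1)\,\delta(x-1/3).$$
   Context: Multiplicative characters of $\mathbb{F}_q^\times$ are extended to $\mathbb{F}_q$ by setting $\chi(0)=0$ (including the trivial character $\varepsilon$, so $\varepsilon(0)=0$). $\phi$ denotes the quadratic character, $\overline{A}=A^{ -1}$, and products of characters are pointwise (e.g. $\overline{B}C(t)=\overline B(t)C(t)$). $\delta(y)=1$ if $y=0$ and $\delta(y)=0$ otherwise. The Jacobi sum is $J(A,B)=\sum_{t\in\mathbb{F}_q}A(t)B(1-t)$. For characters $A,B,C$ and $\lambda\in\mathbb{F}_q$, ${}_2\mathbb{P}_1(A,B;C;\lambda)=\sum_{y\in\mathbb{F}_q}B(y)\,\overline{B}C(1-y)\,\overline{A}(1-\lambda y)$ and ${}_2\mathbb{F}_1(A,B;C;\lambda)={}_2\mathbb{P}_1(A,B;C;\lambda)/J(B,\overline{B}C)$. (In characteristic $3$ one has $\phi(-3)=0$, so the terms involving $\phi(-3)$ vanish.) -}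

module Defs where

open import Data.Nat using (ℕ; zero; suc)
open import Data.Bool using (Bool; true; false; if_then_else_)
open import Data.List using (List; []; _∷_; foldr; map)
open import Data.List.Membership.Propositional using (_∈_)
open import Data.List.Relation.Unary.Unique.Propositional using (Unique)
open import Data.List.Relation.Unary.Any using (any?)
open import Relation.Nullary using (¬_; Dec; yes; no)
open import Relation.Nullary.Decidable using (⌊_⌋)
open import Relation.Binary.PropositionalEquality using (_≡_)
open import Relation.Binary.Definitions using (DecidableEquality)
open import Algebra.Core using (Op₁; Op₂)
open import Algebra.Structures using (IsCommutativeRing)

record Field : Set₁ where
  infixl 7 _*_
  infixl 6 _+_ _-_
  infix 8 -_
  infix 9 _⁻¹
  field
    Carrier : Set
    _+_ _*_ : Op₂ Carrier
    -_ _⁻¹  : Op₁ Carrier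
    0# 1#   : Carrier
    isCommutativeRing : IsCommutativeRing _≡_ _+_ _*_ -_ 0# 1#
    0≢1       : ¬ (0# ≡ 1#)
    ⁻¹-inverse : ∀ x → ¬ (x ≡ 0#) → x * (x ⁻¹) ≡ 1#
    0⁻¹≡0     : 0# ⁻¹ ≡ 0#

  _-_ : Op₂ Carrier
  x - y = x + (- y)

  fromℕ : ℕ → Carrier
  fromℕ zero    = 0#
  fromℕ (suc n) = 1# + fromℕ n

record FiniteField : Set₁ where
  field
    field′   : Field
  open Field field′ public
  field
    _≟_      : DecidableEquality Carrier
    elements : List Carrier
    elements-unique   : Unique elements
    elements-complete : ∀ x → x ∈ elements

-- A field of characteristic 0 (the target of the characters; stands
-- in for ℂ).
record CharZeroField : Set₁ where
  field
    field′ : Field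
  open Field field′ public
  field
    char-zero : ∀ n → fromℕ n ≡ 0# → n ≡ 0

module FiniteFieldHypergeometric (𝔽 : FiniteField) (𝕂 : CharZeroField) where

  private
    module F = FiniteField 𝔽
    module K = CharZeroField 𝕂

  F = F.Carrier
  K = K.Carrier

  -- A multiplicative character of F_q^×, extended by χ(0) = 0:
  -- a multiplicative map F → K with χ(1) = 1 and χ(0) = 0.
  -- (Then χ restricted to F^× is a group hom F^× → K^×, and every such
  -- hom arises uniquely this way.)
  record Character : Set where
    field
      χ     : F → K
      χ-0   : χ F.0# ≡ K.0#
      χ-1   : χ F.1# ≡ K.1#
      χ-mul : ∀ x y → χ (x F.* y) ≡ χ x K.* χ y
  open Character public

  Fun : Set
  Fun = F → K

  _·_ : Fun → Fun → Fun
  (A · B) t = A t K.* B t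

  -- conjugate (inverse) character:  Ā(t) = A(t⁻¹)   (so Ā(0) = A(0) = 0)
  bar : Fun → Fun
  bar A t = A (t F.⁻¹)

  cube : Fun → Fun
  cube A = A · (A · A)

  ΣF : (F → K) → K
  ΣF f = foldr (λ t acc → f t K.+ acc) K.0# F.elements

  δ : F → K
  δ y with y F.≟ F.0#
  ... | yes _ = K.1#
  ... | no  _ = K.0#

  isSquare : F → Bool
  isSquare x = ⌊ any? (λ y → (y F.* y) F.≟ x) F.elements ⌋

  φ : Fun
  φ x with x F.≟ F.0#
  ... | yes _ = K.0#
  ... | no  _ = if isSquare x then K.1# else K.- K.1#

  J : Fun → Fun → K
  J A B = ΣF (λ t → A t K.* B (F.1# F.- t))

  ₂P₁ : Fun → Fun → Fun → F → K
  ₂P₁ A B C λ′ = ΣF (λ y → B y K.* (bar B · C) (F.1# F.- y)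
                              K.* bar A (F.1# F.- (λ′ F.* y)))

  ₂F₁ : Fun → Fun → Fun → F → K
  ₂F₁ A B C λ′ = ₂P₁ A B C λ′ K.* (J B (bar B · C)) K.⁻¹

{-# OPTIONS --safe #-}
-- Put c = -4λ.  The finite-field version of 2F1(a, -a; 1/2; sin²θ) = cos 2aθ is
--   2F1(A, Ā; φ; λ) = Σ A(u) over the u with u + 1/u = 2 + c.
-- To prove it, compare the coefficients of A(t) in 2P1(A, Ā; φ; λ) and in the product of the
-- Jacobi sum and the right-hand side: on one side Σ φ(1 - y) over the roots y of
-- t y (1 - λ y) = 1 - y, on the other Σ φ(t (t + u)) over the above u.  Each quadratic equation has
-- a discriminant which is, up to squares, the product of the φ-arguments at the two roots of the
-- other, so both sums vanish unless both equations are solvable, and then the φ-values agree.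
-- The theorem is now the triple-angle formula: if u + 1/u = 2 - 3x, then
-- u³ + 1/u³ = 2 - 27x(1 - x)².  The two discriminants differ by the square of 3(1 - x)(1 - 3x);
-- the delta terms account for the zeros of that factor.
module Submission where

open import Defs
open import Level using (0ℓ)
open import Data.Nat using (ℕ; zero; suc)
import Data.Nat as ℕ
import Data.Nat.Properties as ℕₚ
open import Data.Integer using (ℤ; +_; -[1+_])
import Data.Integer as ℤ
import Data.Integer.Properties as ℤₚ
open import Data.Maybe using (Maybe; just; nothing)
open import Data.Product using (∃; _×_; _,_; proj₁; proj₂)
open import Data.Sum as Sum using (_⊎_; inj₁; inj₂)
open import Data.List using (List; []; _∷_; foldr)
open import Data.List.Membership.Propositional using (_∈_; lose)
open import Data.List.Relation.Unary.All as All using (All)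
open import Data.List.Relation.Unary.AllPairs using (_∷_)
open import Data.List.Relation.Unary.Any using (any?; here; there; satisfied)
open import Data.List.Relation.Unary.Unique.Propositional using (Unique)
open import Relation.Nullary using (¬_; Dec; yes; no; contradiction)
open import Relation.Binary.PropositionalEquality
  using (_≡_; refl; sym; trans; cong; cong₂; subst; module ≡-Reasoning)
open import Algebra.Bundles using (CommutativeRing)
open import Algebra.Solver.Ring.AlmostCommutativeRing
  using (AlmostCommutativeRing; fromCommutativeRing; _-Raw-AlmostCommutative⟶_)
import Algebra.Solver.Ring
import Algebra.Properties.Ring
import Algebra.Properties.AbelianGroup

-- The coefficients to be compared arise as follows. The three values of A in ₂P₁ merge into A(t)
-- with t = (1 - y)/(y (1 - λy)), leaving φ(1 - y). At λ = 0 this turns the Jacobi sum into Σ A(t)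
-- φ(t (t + 1)). Scaling t by u gives A(u) times this sum as Σ A(t) φ(t (t + u)), so the product
-- with Σ A(u) is again a sum over t with weight A(t). What remains to be shown for each t no longer
-- involves A. The target K is an arbitrary field of characteristic 0, so the Jacobi sum cannot be
-- seen to be nonzero from its absolute value; a double sum is evaluated in two ways instead. The
-- character φ is defined by a search for square roots, and its multiplicativity is obtained by
-- counting.

-- Field arithmetic and a ring solver with integer coefficients

module FieldProperties (𝕜 : Field) where
  open Field 𝕜

  commutativeRing : CommutativeRing 0ℓ 0ℓ
  commutativeRing = record { isCommutativeRing = isCommutativeRing }

  open CommutativeRing commutativeRing
    using (ring; +-abelianGroup; +-assoc; +-comm; +-identityˡ; +-identityʳ; -‿inverseˡ; -‿inverseʳ;
           *-assoc; *-comm;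
           *-identityˡ; *-identityʳ; distribˡ; distribʳ; zeroˡ; zeroʳ) public
  open Algebra.Properties.Ring ring
    using (-‿distribˡ-*; -‿distribʳ-*) public
  open Algebra.Properties.AbelianGroup +-abelianGroup
    using () renaming (⁻¹-∙-comm to -‿+-comm; ⁻¹-involutive to -‿involutive; ε⁻¹≈ε to -0≡0) public

  -- The case split makes the solver constants + 1 and + n (n ≥ 2) evaluate
  -- definitionally to 1# and fromℕ n.
  fromℤ : ℤ → Carrier
  fromℤ (+ 1)      = 1#
  fromℤ (+ n)      = fromℕ n
  fromℤ -[1+ n ]   = - fromℕ (suc n)

  fromℤ-+ : ∀ n → fromℤ (+ n) ≡ fromℕ n
  fromℤ-+ 0             = refl
  fromℤ-+ 1             = sym (+-identityʳ 1#)
  fromℤ-+ (suc (suc n)) = refl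

  fromℕ-+ : ∀ m n → fromℕ (m ℕ.+ n) ≡ fromℕ m + fromℕ n
  fromℕ-+ zero    n = sym (+-identityˡ _)
  fromℕ-+ (suc m) n = trans (cong (_+_ 1#) (fromℕ-+ m n)) (sym (+-assoc _ _ _))

  fromℕ-* : ∀ m n → fromℕ (m ℕ.* n) ≡ fromℕ m * fromℕ n
  fromℕ-* zero    n = sym (zeroˡ _)
  fromℕ-* (suc m) n = begin
    fromℕ (n ℕ.+ m ℕ.* n)                ≡⟨ fromℕ-+ n (m ℕ.* n) ⟩
    fromℕ n + fromℕ (m ℕ.* n)            ≡⟨ cong₂ _+_ (sym (*-identityˡ _)) (fromℕ-* m n) ⟩
    1# * fromℕ n + fromℕ m * fromℕ n     ≡⟨ distribʳ (fromℕ n) 1# (fromℕ m) ⟨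
    (1# + fromℕ m) * fromℕ n             ∎
    where open ≡-Reasoning

  fromℤ-neg : ∀ i → fromℤ (ℤ.- i) ≡ - fromℤ i
  fromℤ-neg (+ 0)             = sym -0≡0
  fromℤ-neg (+ 1)             = cong -_ (+-identityʳ 1#)
  fromℤ-neg (+ suc (suc n))   = refl
  fromℤ-neg -[1+ n ]          = trans (fromℤ-+ (suc n)) (sym (-‿involutive _))

  fromℤ-⊖ : ∀ m n → fromℤ (m ℤ.⊖ n) ≡ fromℕ m - fromℕ n
  fromℤ-⊖ zero    zero    = sym (-‿inverseʳ 0#)
  fromℤ-⊖ zero    (suc n) = sym (+-identityˡ _)
  fromℤ-⊖ (suc m) zero    = trans (fromℤ-+ (suc m)) (sym (trans (cong (_+_ _) -0≡0) (+-identityʳ _)))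
  fromℤ-⊖ (suc m) (suc n) = begin
    fromℤ (suc m ℤ.⊖ suc n)                       ≡⟨ cong fromℤ (ℤₚ.[1+m]⊖[1+n]≡m⊖n m n) ⟩
    fromℤ (m ℤ.⊖ n)                               ≡⟨ fromℤ-⊖ m n ⟩
    fromℕ m - fromℕ n                             ≡⟨ +-identityˡ _ ⟨
    0# + (fromℕ m - fromℕ n)                      ≡⟨ cong (λ z → z + (fromℕ m - fromℕ n)) (-‿inverseʳ 1#) ⟨
    1# - 1# + (fromℕ m - fromℕ n)                 ≡⟨ +-assoc _ _ _ ⟩
    1# + (- 1# + (fromℕ m - fromℕ n))             ≡⟨ cong (_+_ 1#) (trans (sym (+-assoc _ _ _))
                                                       (trans (cong (λ z → z - fromℕ n) (+-comm _ _)) (+-assoc _ _ _))) ⟩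
    1# + (fromℕ m + (- 1# - fromℕ n))             ≡⟨ +-assoc _ _ _ ⟨
    1# + fromℕ m + (- 1# - fromℕ n)               ≡⟨ cong (_+_ (1# + fromℕ m)) (-‿+-comm 1# (fromℕ n)) ⟩
    1# + fromℕ m - (1# + fromℕ n)                 ∎
    where open ≡-Reasoning

  fromℤ-+-homo : ∀ i j → fromℤ (i ℤ.+ j) ≡ fromℤ i + fromℤ j
  fromℤ-+-homo (+ m)    (+ n)    = trans (fromℤ-+ (m ℕ.+ n))
    (trans (fromℕ-+ m n) (sym (cong₂ _+_ (fromℤ-+ m) (fromℤ-+ n))))
  fromℤ-+-homo (+ m)    -[1+ n ] = trans (fromℤ-⊖ m (suc n)) (cong (λ z → z - _) (sym (fromℤ-+ m)))
  fromℤ-+-homo -[1+ m ] (+ n)    = trans (fromℤ-⊖ n (suc m))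
    (trans (cong (λ z → z - _) (sym (fromℤ-+ n))) (+-comm _ _))
  fromℤ-+-homo -[1+ m ] -[1+ n ] = trans
    (cong (λ k → - fromℕ (suc k)) (sym (ℕₚ.+-suc m n)))
    (trans (cong -_ (fromℕ-+ (suc m) (suc n))) (sym (-‿+-comm _ _)))

  fromℤ-+*-homo : ∀ m j → fromℤ (+ m ℤ.* j) ≡ fromℤ (+ m) * fromℤ j
  fromℤ-+*-homo m (+ n) = trans (cong fromℤ (sym (ℤₚ.pos-* m n)))
    (trans (fromℤ-+ (m ℕ.* n)) (trans (fromℕ-* m n) (sym (cong₂ _*_ (fromℤ-+ m) (fromℤ-+ n)))))
  fromℤ-+*-homo m -[1+ n ] = begin
    fromℤ (+ m ℤ.* -[1+ n ])          ≡⟨ cong fromℤ (ℤₚ.neg-distribʳ-* (+ m) (+ suc n)) ⟨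
    fromℤ (ℤ.- (+ m ℤ.* + suc n))     ≡⟨ fromℤ-neg (+ m ℤ.* + suc n) ⟩
    - fromℤ (+ m ℤ.* + suc n)         ≡⟨ cong -_ (fromℤ-+*-homo m (+ suc n)) ⟩
    - (fromℤ (+ m) * fromℤ (+ suc n)) ≡⟨ -‿distribʳ-* _ _ ⟩
    fromℤ (+ m) * - fromℤ (+ suc n)   ≡⟨ cong (λ z → fromℤ (+ m) * - z) (fromℤ-+ (suc n)) ⟩
    fromℤ (+ m) * fromℤ -[1+ n ]      ∎
    where open ≡-Reasoning

  fromℤ-*-homo : ∀ i j → fromℤ (i ℤ.* j) ≡ fromℤ i * fromℤ j
  fromℤ-*-homo (+ m)    j = fromℤ-+*-homo m j
  fromℤ-*-homo -[1+ m ] j = begin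
    fromℤ (-[1+ m ] ℤ.* j)            ≡⟨ cong fromℤ (ℤₚ.neg-distribˡ-* (+ suc m) j) ⟨
    fromℤ (ℤ.- (+ suc m ℤ.* j))       ≡⟨ fromℤ-neg (+ suc m ℤ.* j) ⟩
    - fromℤ (+ suc m ℤ.* j)           ≡⟨ cong -_ (fromℤ-+*-homo (suc m) j) ⟩
    - (fromℤ (+ suc m) * fromℤ j)     ≡⟨ -‿distribˡ-* _ _ ⟩
    - fromℤ (+ suc m) * fromℤ j       ≡⟨ cong (λ z → - z * fromℤ j) (fromℤ-+ (suc m)) ⟩
    fromℤ -[1+ m ] * fromℤ j          ∎
    where open ≡-Reasoning

  almostCommutativeRing : AlmostCommutativeRing 0ℓ 0ℓ
  almostCommutativeRing = fromCommutativeRing commutativeRing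

  fromℤ-morphism : ℤ.+-*-rawRing -Raw-AlmostCommutative⟶ almostCommutativeRing
  fromℤ-morphism = record
    { ⟦_⟧ = fromℤ
    ; +-homo = fromℤ-+-homo ; *-homo = fromℤ-*-homo ; -‿homo = fromℤ-neg
    ; 0-homo = refl ; 1-homo = refl }

  -- Distinct integers may have the same image in positive characteristic, so a failed comparison
  -- yields `nothing` and no refutation.
  fromℤ-≟ : ∀ i j → Maybe (fromℤ i ≡ fromℤ j)
  fromℤ-≟ i j with i ℤ.≟ j
  ... | yes p = just (cong fromℤ p)
  ... | no  _ = nothing

  module Solver = Algebra.Solver.Ring ℤ.+-*-rawRing almostCommutativeRing fromℤ-morphism fromℤ-≟
  open Solver using (solve; Polynomial; _:=_; _:+_; _:*_; _:-_; :-_) public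

  infix 9 #_
  #_ : ∀ {n} → ℕ → Polynomial n
  # k = Solver.con (+ k)

  -- a ≡ b is deduced from hypotheses l ≡ r by writing a - b as a linear
  -- combination of the differences l - r.
  combine₁ : ∀ {a b l r} k → l ≡ r → a - b ≡ k * (l - r) → a ≡ b
  combine₁ {a} {b} {l} {r} k l≡r eq = begin
    a                      ≡⟨ solve 2 (λ a b → a := b :+ (a :- b)) refl a b ⟩
    b + (a - b)            ≡⟨ cong (_+_ b) eq ⟩
    b + k * (l - r)        ≡⟨ cong (λ z → b + k * (z - r)) l≡r ⟩
    b + k * (r - r)        ≡⟨ solve 3 (λ b k r → b :+ k :* (r :- r) := b) refl b k r ⟩
    b                      ∎
    where open ≡-Reasoning

  combine₂ : ∀ {a b l r l′ r′} k k′ → l ≡ r → l′ ≡ r′ → a - b ≡ k * (l - r) + k′ * (l′ - r′) → a ≡ b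
  combine₂ {l = l} {r} {l′} {r′} k k′ l≡r l′≡r′ eq =
    combine₁ k l≡r (trans eq (combine₁ k′ l′≡r′
      (solve 6 (λ k l r k′ l′ r′ → k :* (l :- r) :+ k′ :* (l′ :- r′) :- k :* (l :- r) := k′ :* (l′ :- r′))
        refl k l r k′ l′ r′)))

  combine₃ : ∀ {a b l r l′ r′ l″ r″} k k′ k″ → l ≡ r → l′ ≡ r′ → l″ ≡ r″ →
             a - b ≡ k * (l - r) + k′ * (l′ - r′) + k″ * (l″ - r″) → a ≡ b
  combine₃ {l = l} {r} {l′} {r′} {l″} {r″} k k′ k″ l≡r l′≡r′ l″≡r″ eq =
    combine₂ k k′ l≡r l′≡r′ (trans eq (combine₁ k″ l″≡r″
      (solve 3 (λ s k d → s :+ k :* d :- s := k :* d) refl (k * (l - r) + k′ * (l′ - r′)) k″ (l″ - r″))))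

  infix 4 _≢_
  _≢_ : Carrier → Carrier → Set
  x ≢ y = ¬ (x ≡ y)

  x-y≡0⇒x≡y : ∀ {x y} → x - y ≡ 0# → x ≡ y
  x-y≡0⇒x≡y {x} {y} p = combine₁ 1# p (solve 2 (λ x y → x :- y := # 1 :* (x :- y :- # 0)) refl x y)

  x≡y⇒x-y≡0 : ∀ {x y} → x ≡ y → x - y ≡ 0#
  x≡y⇒x-y≡0 {x} refl = -‿inverseʳ x

  0*y≡0 : ∀ {x y} → x ≡ 0# → x * y ≡ 0#
  0*y≡0 {y = y} refl = zeroˡ y

  x*0≡0 : ∀ {x y} → y ≡ 0# → x * y ≡ 0#
  x*0≡0 {x} refl = zeroʳ x

  1*y≡y : ∀ {x y} → x ≡ 1# → x * y ≡ y
  1*y≡y {y = y} refl = *-identityˡ y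

  x*1≡x : ∀ {x y} → y ≡ 1# → x * y ≡ x
  x*1≡x {x} refl = *-identityʳ x

  *-cancelˡ : ∀ {x y z} → x ≢ 0# → x * y ≡ x * z → y ≡ z
  *-cancelˡ {x} {y} {z} x≢0 p = combine₂ (y - z) (- (x ⁻¹)) (sym (⁻¹-inverse x x≢0)) (sym p)
    (solve 4 (λ x i y z → y :- z := (y :- z) :* (# 1 :- x :* i) :+ (:- i) :* (x :* z :- x :* y)) refl x (x ⁻¹) y z)

  x*y≡0⇒y≡0 : ∀ {x y} → x ≢ 0# → x * y ≡ 0# → y ≡ 0#
  x*y≡0⇒y≡0 {x} x≢0 p = *-cancelˡ x≢0 (trans p (sym (zeroʳ x)))

  *-≢0 : ∀ {x y} → x ≢ 0# → y ≢ 0# → x * y ≢ 0#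
  *-≢0 x≢0 y≢0 p = y≢0 (x*y≡0⇒y≡0 x≢0 p)

  x*y≡1⇒x≢0 : ∀ {x y} → x * y ≡ 1# → x ≢ 0#
  x*y≡1⇒x≢0 {y = y} p refl = 0≢1 (trans (sym (zeroˡ y)) p)

  ⁻¹-≢0 : ∀ {x} → x ≢ 0# → x ⁻¹ ≢ 0#
  ⁻¹-≢0 {x} x≢0 = x*y≡1⇒x≢0 (trans (*-comm (x ⁻¹) x) (⁻¹-inverse x x≢0))

  ⁻¹-unique : ∀ {x y} → x * y ≡ 1# → y ≡ x ⁻¹
  ⁻¹-unique {x} p = *-cancelˡ x≢0 (trans p (sym (⁻¹-inverse x x≢0)))
    where x≢0 = x*y≡1⇒x≢0 p

  1⁻¹≡1 : 1# ⁻¹ ≡ 1#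
  1⁻¹≡1 = sym (⁻¹-unique (*-identityˡ 1#))

-- Sums over the finite field with values in K

module Sums (𝔽 : FiniteField) (𝕂 : CharZeroField) where
  open FiniteFieldHypergeometric 𝔽 𝕂 public
  module F where
    open FiniteField 𝔽 public
    open FieldProperties field′ public
  module K where
    open CharZeroField 𝕂 public
    open FieldProperties field′ public
  open ≡-Reasoning

  -- Sums over a subset are written as sums over all of F with this weight, so that exchange of
  -- summation and reindexing always concern the same list.
  indicator : {P : Set} → Dec P → K
  indicator (yes _) = K.1#
  indicator (no _)  = K.0#

  indicator-cong : {P Q : Set} → (P → Q) → (Q → P) → (d : Dec P) (e : Dec Q) → indicator d ≡ indicator e
  indicator-cong f g (yes p) (yes q) = refl
  indicator-cong f g (yes p) (no ¬q) = contradiction (f p) ¬q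
  indicator-cong f g (no ¬p) (yes q) = contradiction (g q) ¬p
  indicator-cong f g (no ¬p) (no ¬q) = refl

  indicator-yes : {P : Set} (d : Dec P) → P → indicator d ≡ K.1#
  indicator-yes (yes _) p = refl
  indicator-yes (no ¬p) p = contradiction p ¬p

  indicator-no : {P : Set} (d : Dec P) → ¬ P → indicator d ≡ K.0#
  indicator-no (yes p) ¬p = contradiction p ¬p
  indicator-no (no _)  ¬p = refl

  exists? : {P : F → Set} → (∀ x → Dec (P x)) → ∃ P ⊎ (∀ x → ¬ P x)
  exists? P? with any? P? F.elements
  ... | yes p = inj₁ (satisfied p)
  ... | no ¬p = inj₂ (λ x Px → ¬p (lose (F.elements-complete x) Px))

  sumOver : List F → (F → K) → K
  sumOver xs f = foldr (λ t acc → f t K.+ acc) K.0# xs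

  sumOver-cong : ∀ xs {f g} → (∀ x → f x ≡ g x) → sumOver xs f ≡ sumOver xs g
  sumOver-cong []       f≡g = refl
  sumOver-cong (x ∷ xs) f≡g = cong₂ K._+_ (f≡g x) (sumOver-cong xs f≡g)

  sumOver-+ : ∀ xs f g → sumOver xs (λ x → f x K.+ g x) ≡ sumOver xs f K.+ sumOver xs g
  sumOver-+ []       f g = sym (K.+-identityˡ _)
  sumOver-+ (x ∷ xs) f g = trans (cong (K._+_ _) (sumOver-+ xs f g))
    (K.solve 4 (λ a b c d → a K.:+ b K.:+ (c K.:+ d) K.:= a K.:+ c K.:+ (b K.:+ d)) refl
      (f x) (g x) (sumOver xs f) (sumOver xs g))

  sumOver-* : ∀ xs c f → sumOver xs (λ x → c K.* f x) ≡ c K.* sumOver xs f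
  sumOver-* []       c f = sym (K.zeroʳ c)
  sumOver-* (x ∷ xs) c f = trans (cong (K._+_ _) (sumOver-* xs c f)) (sym (K.distribˡ c (f x) _))

  sumOver-swap : ∀ xs ys (f : F → F → K) →
                 sumOver xs (λ x → sumOver ys (f x)) ≡ sumOver ys (λ y → sumOver xs (λ x → f x y))
  sumOver-swap []       ys f = sym (trans (sumOver-cong ys (λ y → sym (K.zeroˡ K.0#)))
                                     (trans (sumOver-* ys K.0# (λ _ → K.0#)) (K.zeroˡ _)))
  sumOver-swap (x ∷ xs) ys f = trans (cong (K._+_ _) (sumOver-swap xs ys f))
                                     (sym (sumOver-+ ys (f x) (λ y → sumOver xs (λ x → f x y))))

  sumOver-0 : ∀ xs {f} → All (λ x → f x ≡ K.0#) xs → sumOver xs f ≡ K.0#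
  sumOver-0 []       All.[]           = refl
  sumOver-0 (x ∷ xs) (fx≡0 All.∷ fxs≡0) = trans (cong₂ K._+_ fx≡0 (sumOver-0 xs fxs≡0)) (K.+-identityˡ _)

  sumOver-single : ∀ {xs} f {a} → Unique xs → a ∈ xs → (∀ x → ¬ x ≡ a → f x ≡ K.0#) → sumOver xs f ≡ f a
  sumOver-single {x ∷ xs} f (x∉xs ∷ _) (here refl) f≡0 = trans
    (cong (K._+_ _) (sumOver-0 xs (All.map (λ x≢y → f≡0 _ (λ y≡x → x≢y (sym y≡x))) x∉xs)))
    (K.+-identityʳ _)
  sumOver-single {x ∷ xs} f (x∉xs ∷ u) (there a∈xs) f≡0 = trans
    (cong₂ K._+_ (f≡0 x (All.lookup x∉xs a∈xs)) (sumOver-single f u a∈xs f≡0))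
    (K.+-identityˡ _)

  -- The number n counts the entries for which `f-val` selects the second alternative; the last
  -- component recovers the vanishing of every term from n = 0.
  sumOver-0-or-c : ∀ xs f c → (∀ x → f x ≡ K.0# ⊎ f x ≡ c) →
    ∃ λ n → sumOver xs f ≡ K.fromℕ n K.* c × (n ≡ 0 → All (λ x → f x ≡ K.0#) xs)
  sumOver-0-or-c []       f c f-val = 0 , sym (K.zeroˡ c) , λ _ → All.[]
  sumOver-0-or-c (x ∷ xs) f c f-val with sumOver-0-or-c xs f c f-val | f-val x
  ... | n , eq , zeros | inj₁ fx≡0 = n , trans (cong₂ K._+_ fx≡0 eq) (K.+-identityˡ _) , λ n≡0 → fx≡0 All.∷ zeros n≡0
  ... | n , eq , zeros | inj₂ fx≡c = suc n ,
    trans (cong₂ K._+_ fx≡c eq)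
      (K.solve 2 (λ c n → c K.:+ n K.:* c K.:= (K.# 1 K.:+ n) K.:* c) refl c (K.fromℕ n)) , λ ()

  Σ-cong : ∀ {f g} → (∀ x → f x ≡ g x) → ΣF f ≡ ΣF g
  Σ-cong = sumOver-cong F.elements

  Σ-+ : ∀ f g → ΣF (λ x → f x K.+ g x) ≡ ΣF f K.+ ΣF g
  Σ-+ = sumOver-+ F.elements

  Σ-* : ∀ c f → ΣF (λ x → c K.* f x) ≡ c K.* ΣF f
  Σ-* = sumOver-* F.elements

  Σ-swap : ∀ (f : F → F → K) → ΣF (λ x → ΣF (f x)) ≡ ΣF (λ y → ΣF (λ x → f x y))
  Σ-swap = sumOver-swap F.elements F.elements

  Σ-single : ∀ (f : F → K) a → (∀ x → ¬ x ≡ a → f x ≡ K.0#) → ΣF f ≡ f a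
  Σ-single f a = sumOver-single f F.elements-unique (F.elements-complete a)

  -- The sum is n c with c nonzero, so characteristic 0 forces n = 0. This takes the place of a
  -- positivity argument.
  Σ-0-or-c : ∀ {f c} → ¬ c ≡ K.0# → (∀ x → f x ≡ K.0# ⊎ f x ≡ c) → ΣF f ≡ K.0# → ∀ x → f x ≡ K.0#
  Σ-0-or-c {f} {c} c≢0 f-val Σf≡0 x with sumOver-0-or-c F.elements f c f-val
  ... | n , eq , zeros = All.lookup (zeros n≡0) (F.elements-complete x)
    where n≡0 = K.char-zero n (K.x*y≡0⇒y≡0 c≢0 (trans (K.*-comm c _) (trans (sym eq) Σf≡0)))

  Σ-point : ∀ a (f : F → K) → ΣF (λ x → indicator (x F.≟ a) K.* f x) ≡ f a
  Σ-point a f = trans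
    (Σ-single _ a (λ x x≢a → K.0*y≡0 (indicator-no (x F.≟ a) x≢a)))
    (K.1*y≡y (indicator-yes (a F.≟ a) refl))

  -- Groups the terms by the value y of g: a point mass at `g x` is inserted and the two sums are
  -- exchanged.
  Σ-fibre : ∀ (g : F → F) (h : F → F → K) →
            ΣF (λ x → h x (g x)) ≡ ΣF (λ y → ΣF (λ x → indicator (y F.≟ g x) K.* h x y))
  Σ-fibre g h = trans (Σ-cong (λ x → sym (Σ-point (g x) (h x)))) (Σ-swap _)

  -- Each fibre of a bijection is a single point, so this is a case of `Σ-fibre`.
  Σ-reindex : ∀ (g g⁻¹ : F → F) → (∀ y → g (g⁻¹ y) ≡ y) → (∀ x → g⁻¹ (g x) ≡ x) →
              ∀ f → ΣF (λ x → f (g x)) ≡ ΣF f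
  Σ-reindex g g⁻¹ gg⁻¹ g⁻¹g f = trans (Σ-fibre g (λ _ y → f y)) (Σ-cong λ y → trans
    (Σ-cong λ x → cong (K._* f y) (indicator-cong
      (λ { refl → sym (g⁻¹g x) }) (λ { refl → sym (gg⁻¹ y) }) (y F.≟ g x) (x F.≟ g⁻¹ y)))
    (Σ-point (g⁻¹ y) (λ _ → f y)))

  module _ {P : F → Set} (P? : ∀ x → Dec (P x)) (f : F → K) where

    Σ-none : (∀ x → ¬ P x) → ΣF (λ x → indicator (P? x) K.* f x) ≡ K.0#
    Σ-none ¬P = sumOver-0 F.elements (All.universal
      (λ x → K.0*y≡0 (indicator-no (P? x) (¬P x))) F.elements)

    Σ-one : ∀ {a} → P a → (∀ x → P x → x ≡ a) → ΣF (λ x → indicator (P? x) K.* f x) ≡ f a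
    Σ-one {a} Pa only = trans
      (Σ-cong λ x → cong (K._* f x) (indicator-cong (only x) (λ { refl → Pa }) (P? x) (x F.≟ a)))
      (Σ-point a f)

    Σ-two : ∀ {a b} → P a → P b → ¬ a ≡ b → (∀ x → P x → x ≡ a ⊎ x ≡ b) →
            ΣF (λ x → indicator (P? x) K.* f x) ≡ f a K.+ f b
    Σ-two {a} {b} Pa Pb a≢b only = trans
      (Σ-cong λ x → trans (cong (K._* f x) (split x)) (K.distribʳ (f x) _ _))
      (trans (Σ-+ _ _) (cong₂ K._+_ (Σ-point a f) (Σ-point b f)))
      where
      split : ∀ x → indicator (P? x) ≡ indicator (x F.≟ a) K.+ indicator (x F.≟ b)
      split x with x F.≟ a | x F.≟ b
      ... | yes refl | yes refl = contradiction refl a≢b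
      ... | yes refl | no _     = trans (indicator-yes (P? x) Pa) (sym (K.+-identityʳ _))
      ... | no _     | yes refl = trans (indicator-yes (P? x) Pb) (sym (K.+-identityˡ _))
      ... | no x≢a   | no x≢b   = trans (indicator-no (P? x) ¬Px) (sym (K.+-identityˡ _))
        where
        ¬Px : ¬ P x
        ¬Px Px with only x Px
        ... | inj₁ x≡a = x≢a x≡a
        ... | inj₂ x≡b = x≢b x≡b

  *≡0 : ∀ {x y} → x F.* y ≡ F.0# → x ≡ F.0# ⊎ y ≡ F.0#
  *≡0 {x} p with x F.≟ F.0#
  ... | yes x≡0 = inj₁ x≡0
  ... | no  x≢0 = inj₂ (F.x*y≡0⇒y≡0 x≢0 p)

-- The quadratic character: values, sum and multiplicativity

module QuadraticCharacter (𝔽 : FiniteField) (𝕂 : CharZeroField)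
    (2≢0 : ¬ (FiniteField.fromℕ 𝔽 2 ≡ FiniteField.0# 𝔽)) where
  open Sums 𝔽 𝕂 public
  open ≡-Reasoning

  halve : ∀ {x y} → F.fromℕ 2 F.* x ≡ F.fromℕ 2 F.* y → x ≡ y
  halve = F.*-cancelˡ 2≢0

  x≡-x⇒x≡0 : ∀ {x} → x ≡ F.- x → x ≡ F.0#
  x≡-x⇒x≡0 {x} p = halve (F.combine₁ F.1# p
    (solve 1 (λ x → # 2 :* x :- # 2 :* # 0 := # 1 :* (x :- (:- x))) refl x))
    where open F

  x²≡y²⇒x≡±y : ∀ {x y} → x F.* x ≡ y F.* y → x ≡ y ⊎ x ≡ F.- y
  x²≡y²⇒x≡±y {x} {y} p with *≡0 {x F.- y} {x F.+ y} (F.combine₁ F.1# p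
    (solve 2 (λ x y → (x :- y) :* (x :+ y) :- # 0 := # 1 :* (x :* x :- y :* y)) refl x y))
    where open F
  ... | inj₁ q = inj₁ (F.x-y≡0⇒x≡y q)
  ... | inj₂ q = inj₂ (F.combine₁ F.1# q (solve 2 (λ x y → x :- (:- y) := # 1 :* (x :+ y :- # 0)) refl x y))
    where open F

  φ-0 : φ F.0# ≡ K.0#
  φ-0 with F.0# F.≟ F.0#
  ... | yes _  = refl
  ... | no 0≢0 = contradiction refl 0≢0

  φ-square : ∀ {x} y → x F.≢ F.0# → y F.* y ≡ x → φ x ≡ K.1#
  φ-square {x} y x≢0 y²≡x with x F.≟ F.0#
  ... | yes x≡0 = contradiction x≡0 x≢0
  ... | no _ with any? (λ y → (y F.* y) F.≟ x) F.elements
  ...   | yes _ = refl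
  ...   | no ¬p = contradiction (lose (F.elements-complete y) y²≡x) ¬p

  φ-nonsquare : ∀ {x} → (∀ y → ¬ y F.* y ≡ x) → φ x ≡ K.- K.1#
  φ-nonsquare {x} ¬□ with x F.≟ F.0#
  ... | yes refl = contradiction (F.zeroˡ F.0#) (¬□ F.0#)
  ... | no _ with any? (λ y → (y F.* y) F.≟ x) F.elements
  ...   | yes p = contradiction (proj₂ (satisfied p)) (¬□ (proj₁ (satisfied p)))
  ...   | no _  = refl

  -- Keeps the square root that the Boolean `isSquare` forgets. The case `nonsquare` excludes x = 0
  -- by itself, since 0 is the square of 0.
  data QuadraticView (x : F) : Set where
    isZero    : x ≡ F.0# → QuadraticView x
    square    : ∀ y → x F.≢ F.0# → y F.* y ≡ x → QuadraticView x
    nonsquare : (∀ y → ¬ y F.* y ≡ x) → QuadraticView x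

  quadraticView : ∀ x → QuadraticView x
  quadraticView x with x F.≟ F.0# | exists? (λ y → (y F.* y) F.≟ x)
  ... | yes x≡0 | _             = isZero x≡0
  ... | no x≢0  | inj₁ (y , eq) = square y x≢0 eq
  ... | no x≢0  | inj₂ ¬□       = nonsquare ¬□

  nonsquare⇒≢0 : ∀ {x} → (∀ y → ¬ y F.* y ≡ x) → x F.≢ F.0#
  nonsquare⇒≢0 ¬□ refl = ¬□ F.0# (F.zeroˡ F.0#)

  square-root≢0 : ∀ {x y} → x F.≢ F.0# → y F.* y ≡ x → y F.≢ F.0#
  square-root≢0 x≢0 eq refl = x≢0 (trans (sym eq) (F.zeroˡ F.0#))

  nonsquare-*-square : ∀ {a} y → (∀ z → ¬ z F.* z ≡ a) → y F.≢ F.0# → ∀ z → ¬ z F.* z ≡ a F.* (y F.* y)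
  nonsquare-*-square {a} y ¬□ y≢0 z eq = ¬□ (z F.* y F.⁻¹) (F.combine₂
    (y F.⁻¹ F.* y F.⁻¹) (a F.* (F.1# F.+ y F.* y F.⁻¹)) eq (F.⁻¹-inverse y y≢0)
    (solve 4 (λ z i a y → z :* i :* (z :* i) :- a :=
        i :* i :* (z :* z :- a :* (y :* y)) :+ a :* (# 1 :+ y :* i) :* (y :* i :- # 1)) refl z (y F.⁻¹) a y))
    where open F

  -- Counts the square roots of x: one, two or none. Two requires z ≠ -z, hence characteristic other
  -- than 2. The factor 1 is kept to match the inner sum of `Σ-fibre`.
  Σ-square-roots : ∀ x → ΣF (λ y → indicator (x F.≟ (y F.* y)) K.* K.1#) ≡ K.1# K.+ φ x
  Σ-square-roots x with quadraticView x
  ... | isZero refl = trans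
          (Σ-one (λ y → F.0# F.≟ (y F.* y)) _ (sym (F.zeroˡ F.0#)) only0)
          (sym (trans (cong (K._+_ K.1#) φ-0) (K.+-identityʳ K.1#)))
    where
    only0 : ∀ y → F.0# ≡ y F.* y → y ≡ F.0#
    only0 y eq with *≡0 (sym eq)
    ... | inj₁ p = p
    ... | inj₂ p = p
  ... | square z x≢0 refl = trans
          (Σ-two (λ y → (z F.* z) F.≟ (y F.* y)) _ refl (solve 1 (λ z → z :* z := :- z :* (:- z)) refl z)
            (λ z≡-z → square-root≢0 x≢0 refl (x≡-x⇒x≡0 z≡-z)) (λ y eq → x²≡y²⇒x≡±y (sym eq)))
          (cong (K._+_ K.1#) (sym (φ-square z x≢0 refl)))
    where open F
  ... | nonsquare ¬□ = trans (Σ-none (λ y → x F.≟ (y F.* y)) _ (λ y eq → ¬□ y (sym eq)))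
          (sym (trans (cong (K._+_ K.1#) (φ-nonsquare ¬□)) (K.-‿inverseʳ K.1#)))

  -- Every y is a square root of exactly one x, so grouping F by squares gives q = Σ (1 + φ(x)) = q
  -- + Σ φ(x).
  Σφ≡0 : ΣF φ ≡ K.0#
  Σφ≡0 = K.combine₁ K.1# count (solve 2 (λ q s → s :- # 0 := # 1 :* (q :+ s :- q)) refl _ _)
    where
    open K
    count : ΣF (λ _ → K.1#) K.+ ΣF φ ≡ ΣF (λ _ → K.1#)
    count = trans (sym (Σ-+ (λ _ → K.1#) φ)) (trans (Σ-cong (λ x → sym (Σ-square-roots x)))
      (sym (Σ-fibre (λ y → y F.* y) (λ _ _ → K.1#))))

  Σ-dilate : ∀ {a} → a F.≢ F.0# → ∀ f → ΣF (λ x → f (a F.* x)) ≡ ΣF f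
  Σ-dilate {a} a≢0 = Σ-reindex (a F.*_) (a F.⁻¹ F.*_)
    (λ y → F.combine₁ y (F.⁻¹-inverse a a≢0)
      (solve 3 (λ a i y → a :* (i :* y) :- y := y :* (a :* i :- # 1)) refl a (a F.⁻¹) y))
    (λ y → F.combine₁ y (F.⁻¹-inverse a a≢0)
      (solve 3 (λ a i y → i :* (a :* y) :- y := y :* (a :* i :- # 1)) refl a (a F.⁻¹) y))
    where open F

  Σ-translate : ∀ a f → ΣF (λ x → f (x F.+ a)) ≡ ΣF f
  Σ-translate a = Σ-reindex (F._+ a) (F._- a)
    (λ y → solve 2 (λ a y → y :- a :+ a := y) refl a y)
    (λ y → solve 2 (λ a y → y :+ a :- a := y) refl a y)
    where open F

  φ-unit : ∀ {x} → x F.≢ F.0# → φ x ≡ K.1# ⊎ φ x ≡ K.- K.1#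
  φ-unit {x} x≢0 with quadraticView x
  ... | isZero x≡0     = contradiction x≡0 x≢0
  ... | square y _ eq  = inj₁ (φ-square y x≢0 eq)
  ... | nonsquare ¬□   = inj₂ (φ-nonsquare ¬□)

  -- The terms φ(ax) + φ(x) take only the values 0 and -2 and add up to 0, so they all vanish.
  φ-nonsquare-* : ∀ {a} → (∀ y → ¬ y F.* y ≡ a) → ∀ x → φ (a F.* x) K.+ φ x ≡ K.0#
  φ-nonsquare-* {a} ¬□ = Σ-0-or-c -2≢0 values
    (trans (Σ-+ _ φ) (trans (cong₂ K._+_ (trans (Σ-dilate a≢0 φ) Σφ≡0) Σφ≡0) (K.+-identityˡ K.0#)))
    where
    a≢0 = nonsquare⇒≢0 ¬□
    -2≢0 : ¬ K.- K.fromℕ 2 ≡ K.0#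
    -2≢0 p with K.char-zero 2 (trans (sym (K.-‿involutive _)) (trans (cong K.-_ p) K.-0≡0))
    ... | ()
    values : ∀ x → φ (a F.* x) K.+ φ x ≡ K.0# ⊎ φ (a F.* x) K.+ φ x ≡ K.- K.fromℕ 2
    values x with quadraticView x
    ... | isZero refl = inj₁ (trans (cong₂ K._+_ (trans (cong φ (F.zeroʳ a)) φ-0) φ-0) (K.+-identityˡ K.0#))
    ... | square y x≢0 refl = inj₁ (trans
          (cong₂ K._+_ (φ-nonsquare (nonsquare-*-square y ¬□ (square-root≢0 x≢0 refl))) (φ-square y x≢0 refl))
          (K.-‿inverseˡ K.1#))
    ... | nonsquare ¬□x with φ-unit (F.*-≢0 a≢0 (nonsquare⇒≢0 ¬□x))
    ...   | inj₁ φax≡1  = inj₁ (trans (cong₂ K._+_ φax≡1 (φ-nonsquare ¬□x)) (K.-‿inverseʳ K.1#))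
    ...   | inj₂ φax≡-1 = inj₂ (trans (cong₂ K._+_ φax≡-1 (φ-nonsquare ¬□x))
              (solve 0 (:- # 1 :+ (:- # 1) := :- # 2) refl))
      where open K

  φ-*-square : ∀ {y} → y F.≢ F.0# → ∀ x → φ (x F.* (y F.* y)) ≡ φ x
  φ-*-square {y} y≢0 x with quadraticView x
  ... | isZero refl       = cong φ (F.zeroˡ (y F.* y))
  ... | square z x≢0 refl = trans (φ-square (z F.* y) (F.*-≢0 x≢0 (F.*-≢0 y≢0 y≢0))
          (solve 2 (λ y z → z :* y :* (z :* y) := z :* z :* (y :* y)) refl y z))
        (sym (φ-square z x≢0 refl))
    where open F
  ... | nonsquare ¬□      = trans (φ-nonsquare (nonsquare-*-square y ¬□ y≢0)) (sym (φ-nonsquare ¬□))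

  -- The critical case is a product of two nonsquares, which has to be a square; `φ-nonsquare-*`
  -- supplies it by counting.
  φ-* : ∀ x y → φ (x F.* y) ≡ φ x K.* φ y
  φ-* x y with quadraticView x
  ... | isZero refl = trans (trans (cong φ (F.zeroˡ y)) φ-0)
                            (sym (K.0*y≡0 φ-0))
  ... | square z x≢0 refl = begin
          φ (z F.* z F.* y)       ≡⟨ cong φ (F.*-comm (z F.* z) y) ⟩
          φ (y F.* (z F.* z))     ≡⟨ φ-*-square (square-root≢0 x≢0 refl) y ⟩
          φ y                     ≡⟨ K.*-identityˡ (φ y) ⟨
          K.1# K.* φ y            ≡⟨ cong (K._* φ y) (φ-square z x≢0 refl) ⟨
          φ (z F.* z) K.* φ y     ∎
  ... | nonsquare ¬□ = trans
          (K.combine₁ K.1# (φ-nonsquare-* ¬□ y)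
            (solve 2 (λ a b → a :- :- # 1 :* b := # 1 :* (a :+ b :- # 0)) refl (φ (x F.* y)) (φ y)))
          (cong (K._* φ y) (sym (φ-nonsquare ¬□)))
    where open K

  φ-1 : φ F.1# ≡ K.1#
  φ-1 = φ-square F.1# (λ 1≡0 → F.0≢1 (sym 1≡0)) (F.*-identityˡ F.1#)

  φ*φ : ∀ {x} → x F.≢ F.0# → φ x K.* φ x ≡ K.1#
  φ*φ {x} x≢0 = trans (sym (φ-* x x)) (φ-square x (F.*-≢0 x≢0 x≢0) refl)

  -- Here φ(a) φ(b) = 1, and each of the two values is its own inverse.
  φ-≡ : ∀ {a b} z → a F.≢ F.0# → b F.≢ F.0# → z F.* z ≡ a F.* b → φ a ≡ φ b
  φ-≡ {a} {b} z a≢0 b≢0 z²≡ab = K.combine₂ (φ b) (K.- φ a)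
    (trans (sym (φ-* a b)) (φ-square z (F.*-≢0 a≢0 b≢0) z²≡ab)) (φ*φ b≢0)
    (solve 2 (λ a b → a :- b := b :* (a :* b :- # 1) :+ (:- a) :* (b :* b :- # 1)) refl (φ a) (φ b))
    where open K

  -- Here φ(a) φ(b) = -1, so the values are opposite. This cancels the two roots of one quadratic
  -- equation when the other has none.
  φ-+≡0 : ∀ {a b} → (∀ y → ¬ y F.* y ≡ a F.* b) → φ a K.+ φ b ≡ K.0#
  φ-+≡0 {a} {b} ¬□ = K.combine₂ (φ b) (K.- φ a)
    (trans (sym (φ-* a b)) (φ-nonsquare ¬□)) (φ*φ b≢0)
    (solve 2 (λ a b → a :+ b :- # 0 := b :* (a :* b :- :- # 1) :+ (:- a) :* (b :* b :- # 1)) refl (φ a) (φ b))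
    where
    open K
    b≢0 : b F.≢ F.0#
    b≢0 refl = ¬□ F.0# (trans (F.zeroˡ F.0#) (sym (F.zeroʳ a)))

-- The two quadratic equations and their sums of φ-values

module QuadraticTransformation (𝔽 : FiniteField) (𝕂 : CharZeroField)
    (2≢0 : ¬ (FiniteField.fromℕ 𝔽 2 ≡ FiniteField.0# 𝔽)) where
  open QuadraticCharacter 𝔽 𝕂 2≢0 public
  open ≡-Reasoning
  open F using (_+_; _*_; _-_; -_; _⁻¹; 0#; 1#; fromℕ; _≢_; _≟_;
                solve; #_; _:=_; _:+_; _:*_; _:-_; :-_; combine₁; combine₂; combine₃)

  square≡0 : ∀ {x} → x * x ≡ 0# → x ≡ 0#
  square≡0 p = Sum.reduce (*≡0 p)

  4≢0 : fromℕ 4 ≢ 0#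
  4≢0 p = F.*-≢0 2≢0 2≢0 (trans (solve 0 (# 2 :* # 2 := # 4) refl) p)

  -≢0 : ∀ {x y} → x ≢ y → x - y ≢ 0#
  -≢0 x≢y p = x≢y (F.x-y≡0⇒x≡y p)

  roots-only : ∀ {x a b} → (x - a) * (x - b) ≡ 0# → x ≡ a ⊎ x ≡ b
  roots-only p = Sum.map F.x-y≡0⇒x≡y F.x-y≡0⇒x≡y (*≡0 p)

  -- The parameter c stands for -4λ, so the condition says u + 1/u = 2 - 4λ.
  Root : F → F → Set
  Root c u = (1# - u) * (1# - u) ≡ c * u

  Root? : ∀ c u → Dec (Root c u)
  Root? c u = ((1# - u) * (1# - u)) ≟ (c * u)

  -- Vieta's relations for u² - (2 + c) u + 1. They allow u = v, so double roots need no separate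
  -- description.
  RootPair : F → F → F → Set
  RootPair c u v = u * v ≡ 1# × u + v ≡ fromℕ 2 + c

  swapRoots : ∀ {c u v} → RootPair c u v → RootPair c v u
  swapRoots {u = u} {v} (uv , u+v) = trans (F.*-comm v u) uv , trans (F.+-comm v u) u+v

  pairRoot : ∀ {c u v} → RootPair c u v → Root c u
  pairRoot {c} {u} {v} (uv , u+v) = combine₂ (- 1#) u uv u+v
    (solve 3 (λ c u v → (# 1 :- u) :* (# 1 :- u) :- c :* u :=
      (:- # 1) :* (u :* v :- # 1) :+ u :* (u :+ v :- (# 2 :+ c))) refl c u v)

  rootPair : ∀ {c u} → Root c u → RootPair c u (u ⁻¹)
  rootPair {c} {u} root = uv , combine₂ (u ⁻¹) (fromℕ 2 - u + c) root uv
    (solve 3 (λ c u v → u :+ v :- (# 2 :+ c) :=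
      v :* ((# 1 :- u) :* (# 1 :- u) :- c :* u) :+ (# 2 :- u :+ c) :* (u :* v :- # 1)) refl c u (u ⁻¹))
    where
    u≢0 : u ≢ 0#
    u≢0 refl = F.0≢1 (sym (combine₁ 1# root
      (solve 1 (λ c → # 1 :- # 0 := # 1 :* ((# 1 :- # 0) :* (# 1 :- # 0) :- c :* # 0)) refl c)))
    uv : u * u ⁻¹ ≡ 1#
    uv = F.⁻¹-inverse u u≢0

  pairOnly : ∀ {c u v} → RootPair c u v → ∀ z → Root c z → z ≡ u ⊎ z ≡ v
  pairOnly {c} {u} {v} (uv , u+v) z root = roots-only (combine₃ 1# 1# (- z) root uv u+v
    (solve 4 (λ c u v z → (z :- u) :* (z :- v) :- # 0 := # 1 :* ((# 1 :- z) :* (# 1 :- z) :- c :* z)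
      :+ # 1 :* (u :* v :- # 1) :+ (:- z) :* (u :+ v :- (# 2 :+ c))) refl c u v z))

  RootSum : (F → K) → F → K
  RootSum f c = ΣF (λ u → indicator (Root? c u) K.* f u)

  RootSum-two : ∀ f {c u v} → RootPair c u v → u ≢ v → RootSum f c ≡ f u K.+ f v
  RootSum-two f {c} uv u≢v = Σ-two (Root? c) f (pairRoot uv) (pairRoot (swapRoots uv)) u≢v (pairOnly uv)

  RootSum-one : ∀ f {c u} → RootPair c u u → RootSum f c ≡ f u
  RootSum-one f {c} {u} uu = Σ-one (Root? c) f (pairRoot uu) (λ z root → Sum.reduce (pairOnly uu z root))

  -- The equation in y says t = (1 - y) / (y (1 - λ y)).
  Fibre : F → F → F → Set
  Fibre lam t y = t * (y * (1# - lam * y)) ≡ 1# - y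

  Fibre? : ∀ lam t y → Dec (Fibre lam t y)
  Fibre? lam t y = (t * (y * (1# - lam * y))) ≟ (1# - y)

  -- The coefficient of A(t) in ₂P₁ after the terms are grouped by t; see `₂P₁-fibres`.
  FibreSum : F → F → K
  FibreSum lam t = ΣF (λ y → indicator (Fibre? lam t y) K.* φ (1# - y))

  module NonzeroParameters {lam t : F} (lam≢0 : lam ≢ 0#) (t≢0 : t ≢ 0#) where
    private
      c : F
      c = - (fromℕ 4 * lam)

      c≢0 : c ≢ 0#
      c≢0 p = F.*-≢0 4≢0 lam≢0 (combine₁ (- 1#) p (solve 1 (λ x → x :- # 0 := (:- # 1) :* (:- x :- # 0)) refl _))

    -- Vieta's relations for tλ y² - (1 + t) y + 1, multiplied by tλ to avoid division. The leading
    -- coefficient is nonzero in this module; λ = 0 is treated by `FibreSum-0`.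
    FibrePair : F → F → Set
    FibrePair y y′ = t * lam * (y * y′) ≡ 1# × t * lam * (y + y′) ≡ 1# + t

    swapFibre : ∀ {y y′} → FibrePair y y′ → FibrePair y′ y
    swapFibre {y} {y′} (p , s) = trans (cong (t * lam *_) (F.*-comm y′ y)) p ,
                                 trans (cong (t * lam *_) (F.+-comm y′ y)) s

    pairFibre : ∀ {y y′} → FibrePair y y′ → Fibre lam t y
    pairFibre {y} {y′} (p , s) = combine₂ 1# (- y) p s
      (solve 4 (λ l t y y′ → t :* (y :* (# 1 :- l :* y)) :- (# 1 :- y) :=
        # 1 :* (t :* l :* (y :* y′) :- # 1) :+ (:- y) :* (t :* l :* (y :+ y′) :- (# 1 :+ t))) refl lam t y y′)

    fibrePair : ∀ {y} → Fibre lam t y → FibrePair y ((t * lam * y) ⁻¹)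
    fibrePair {y} fib = p , combine₂ (- (t * lam * y′)) (1# + t - t * lam * y) fib p
      (solve 4 (λ l t y y′ → t :* l :* (y :+ y′) :- (# 1 :+ t) :=
        (:- (t :* l :* y′)) :* (t :* (y :* (# 1 :- l :* y)) :- (# 1 :- y))
        :+ (# 1 :+ t :- t :* l :* y) :* (t :* l :* (y :* y′) :- # 1)) refl lam t y y′)
      where
      y′ = (t * lam * y) ⁻¹
      y≢0 : y ≢ 0#
      y≢0 refl = F.0≢1 (combine₁ 1# fib
        (solve 2 (λ l t → # 0 :- # 1 := # 1 :* (t :* (# 0 :* (# 1 :- l :* # 0)) :- (# 1 :- # 0))) refl lam t))
      p : t * lam * (y * y′) ≡ 1#
      p = trans (sym (F.*-assoc (t * lam) y y′)) (F.⁻¹-inverse (t * lam * y) (F.*-≢0 (F.*-≢0 t≢0 lam≢0) y≢0))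

    fibreOnly : ∀ {y y′} → FibrePair y y′ → ∀ z → Fibre lam t z → z ≡ y ⊎ z ≡ y′
    fibreOnly {y} {y′} (p , s) z fib = roots-only (F.x*y≡0⇒y≡0 (F.*-≢0 t≢0 lam≢0)
      (combine₃ (- 1#) (- z) 1# fib s p
        (solve 5 (λ l t y y′ z → t :* l :* ((z :- y) :* (z :- y′)) :- # 0 :=
          (:- # 1) :* (t :* (z :* (# 1 :- l :* z)) :- (# 1 :- z))
          :+ (:- z) :* (t :* l :* (y :+ y′) :- (# 1 :+ t))
          :+ # 1 :* (t :* l :* (y :* y′) :- # 1)) refl lam t y y′ z)))

    FibreSum-two : ∀ {y y′} → FibrePair y y′ → y ≢ y′ → FibreSum lam t ≡ φ (1# - y) K.+ φ (1# - y′)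
    FibreSum-two yy′ y≢y′ = Σ-two (Fibre? lam t) _ (pairFibre yy′) (pairFibre (swapFibre yy′)) y≢y′ (fibreOnly yy′)

    FibreSum-one : ∀ {y} → FibrePair y y → FibreSum lam t ≡ φ (1# - y)
    FibreSum-one {y} yy = Σ-one (Fibre? lam t) _ (pairFibre yy) (λ z fib → Sum.reduce (fibreOnly yy z fib))

    -- The quadratic polynomial in y takes the value t (λ - 1) at y = 1; the common factor t is
    -- cancelled.
    1-y-product : ∀ {y y′} → FibrePair y y′ → lam * ((1# - y) * (1# - y′)) ≡ lam - 1#
    1-y-product {y} {y′} (p , s) = F.*-cancelˡ t≢0 (combine₂ 1# (- 1#) p s
      (solve 4 (λ l t y y′ → t :* (l :* ((# 1 :- y) :* (# 1 :- y′))) :- t :* (l :- # 1) :=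
        # 1 :* (t :* l :* (y :* y′) :- # 1) :+ (:- # 1) :* (t :* l :* (y :+ y′) :- (# 1 :+ t))) refl lam t y y′))

    -- The polynomial with roots u and v is evaluated at -t. The result is the discriminant of the
    -- quadratic in y, as `fibreDiscriminant` shows.
    t+u-product : ∀ {u v} → RootPair c u v → (t + u) * (t + v) ≡ (1# + t) * (1# + t) - fromℕ 4 * (t * lam)
    t+u-product {u} {v} (uv , u+v) = combine₂ 1# t uv u+v
      (solve 4 (λ l t u v → (t :+ u) :* (t :+ v) :- ((# 1 :+ t) :* (# 1 :+ t) :- # 4 :* (t :* l)) :=
        # 1 :* (u :* v :- # 1) :+ t :* (u :+ v :- (# 2 :+ :- (# 4 :* l)))) refl lam t u v)

    fibreDiscriminant : ∀ {y y′} → FibrePair y y′ →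
      (t * lam * (y - y′)) * (t * lam * (y - y′)) ≡ (1# + t) * (1# + t) - fromℕ 4 * (t * lam)
    fibreDiscriminant {y} {y′} (p , s) = combine₂ (- (fromℕ 4 * (t * lam))) (t * lam * (y + y′) + (1# + t)) p s
      (solve 4 (λ l t y y′ → t :* l :* (y :- y′) :* (t :* l :* (y :- y′))
          :- ((# 1 :+ t) :* (# 1 :+ t) :- # 4 :* (t :* l)) :=
        (:- (# 4 :* (t :* l))) :* (t :* l :* (y :* y′) :- # 1)
        :+ (t :* l :* (y :+ y′) :+ (# 1 :+ t)) :* (t :* l :* (y :+ y′) :- (# 1 :+ t))) refl lam t y y′)

    -- By `1-y-product` the right-hand side is (4λ)² (1 - y)(1 - y′) for any fibre pair, which ties
    -- the solvability in u to the φ-values at the roots y.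
    rootDiscriminant : ∀ {u v} → RootPair c u v →
      (u - v) * (u - v) ≡ fromℕ 4 * fromℕ 4 * (lam * (lam - 1#))
    rootDiscriminant {u} {v} (uv , u+v) = combine₂ (- fromℕ 4) (u + v + (fromℕ 2 + c)) uv u+v
      (solve 3 (λ l u v → (u :- v) :* (u :- v) :- # 4 :* # 4 :* (l :* (l :- # 1)) :=
        (:- # 4) :* (u :* v :- # 1)
        :+ (u :+ v :+ (# 2 :+ :- (# 4 :* l))) :* (u :+ v :- (# 2 :+ :- (# 4 :* l)))) refl lam u v)

    module BothPairs {y y′ u v : F} (yy′ : FibrePair y y′) (uv : RootPair c u v) where
      private
        d z : F
        d = t * lam * (y - y′)
        -- This is α (α + β) in the notation of `transfer-square`, with signs chosen so that αβ = d.
        z = v * (t + u) + d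

      t+u-discriminant : (t + u) * (t + v) ≡ d * d
      t+u-discriminant = trans (t+u-product uv) (sym (fibreDiscriminant yy′))

      1-y-discriminant : (u - v) * (u - v) ≡ fromℕ 4 * fromℕ 4 * (lam * (lam * ((1# - y) * (1# - y′))))
      1-y-discriminant = trans (rootDiscriminant uv)
        (cong (λ k → fromℕ 4 * fromℕ 4 * (lam * k)) (sym (1-y-product yy′)))

      -- With α² = v (t + u) and β² = u (t + v), one has αβ = d and -4tλ(1 - y) = (α + β)²;
      -- multiplying by α² removes the square roots.
      transfer-square : z * z ≡ (1# - y) * (t * (t + u)) * ((1# - v) * (1# - v))
      transfer-square = begin
        z * z
          ≡⟨ combine₂ (- 1#) (- ((t + u) * (t + v))) t+u-discriminant (proj₁ uv)
               (solve 4 (λ d t u v → (v :* (t :+ u) :+ d) :* (v :* (t :+ u) :+ d)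
                   :- v :* (t :+ u) :* (v :* (t :+ u) :+ u :* (t :+ v) :+ # 2 :* d) :=
                 (:- # 1) :* ((t :+ u) :* (t :+ v) :- d :* d) :+ (:- ((t :+ u) :* (t :+ v))) :* (u :* v :- # 1))
                 refl d t u v) ⟩
        v * (t + u) * (v * (t + u) + u * (t + v) + fromℕ 2 * d)
          ≡⟨ cong (v * (t + u) *_) (combine₃ (fromℕ 2) t (- fromℕ 2) (proj₁ uv) (proj₂ uv) (proj₂ yy′)
               (solve 6 (λ l t u v y y′ → v :* (t :+ u) :+ u :* (t :+ v) :+ # 2 :* (t :* l :* (y :- y′))
                   :- (:- (# 4 :* (t :* l :* (# 1 :- y)))) :=
                 # 2 :* (u :* v :- # 1) :+ t :* (u :+ v :- (# 2 :+ :- (# 4 :* l)))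
                 :+ (:- # 2) :* (t :* l :* (y :+ y′) :- (# 1 :+ t))) refl lam t u v y y′)) ⟩
        v * (t + u) * - (fromℕ 4 * (t * lam * (1# - y)))
          ≡⟨ solve 5 (λ l t u v y → v :* (t :+ u) :* (:- (# 4 :* (t :* l :* (# 1 :- y)))) :=
               (# 1 :- y) :* (t :* (t :+ u)) :* ((:- (# 4 :* l)) :* v)) refl lam t u v y ⟩
        (1# - y) * (t * (t + u)) * (c * v)
          ≡⟨ cong ((1# - y) * (t * (t + u)) *_) (pairRoot (swapRoots uv)) ⟨
        (1# - y) * (t * (t + u)) * ((1# - v) * (1# - v)) ∎

      -- Dividing `transfer-square` by (1 - v)² exhibits the product of the two φ-arguments as a
      -- square. The division is allowed because (1 - v)² = c v with c and v nonzero.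
      transfer : 1# - y ≢ 0# → t + u ≢ 0# → φ (1# - y) ≡ φ (t * (t + u))
      transfer w≢0 t+u≢0 = φ-≡ (z * (1# - v) ⁻¹) w≢0 (F.*-≢0 t≢0 t+u≢0) (combine₂
          ((1# - v) ⁻¹ * (1# - v) ⁻¹) (wT * (1# + (1# - v) * (1# - v) ⁻¹)) transfer-square (F.⁻¹-inverse (1# - v) 1-v≢0)
          (solve 4 (λ z i s a → z :* i :* (z :* i) :- a :=
            i :* i :* (z :* z :- a :* (s :* s)) :+ a :* (# 1 :+ s :* i) :* (s :* i :- # 1))
            refl z ((1# - v) ⁻¹) (1# - v) wT))
        where
        wT = (1# - y) * (t * (t + u))
        1-v≢0 : 1# - v ≢ 0#
        1-v≢0 p = F.*-≢0 c≢0 (F.x*y≡1⇒x≢0 (proj₁ (swapRoots uv)))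
          (trans (sym (pairRoot (swapRoots uv))) (trans (cong (λ s → s * s) p) (F.zeroˡ 0#)))

      t+u-vanish : y ≡ y′ → (t + u) * (t + v) ≡ 0#
      t+u-vanish refl = trans t+u-discriminant
        (solve 2 (λ k y → k :* (y :- y) :* (k :* (y :- y)) := # 0) refl (t * lam) y)

      1-y-vanish : u ≡ v → (1# - y) * (1# - y′) ≡ 0#
      1-y-vanish refl = F.x*y≡0⇒y≡0 lam≢0 (F.x*y≡0⇒y≡0 lam≢0 (F.x*y≡0⇒y≡0 (F.*-≢0 4≢0 4≢0)
        (trans (sym 1-y-discriminant) (solve 1 (λ u → (u :- u) :* (u :- u) := # 0) refl u))))

      t+u≢0 : y ≢ y′ → t + u ≢ 0#
      t+u≢0 y≢y′ p = F.*-≢0 d≢0 d≢0 (trans (sym t+u-discriminant) (trans (cong (_* (t + v)) p) (F.zeroˡ (t + v))))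
        where d≢0 = F.*-≢0 (F.*-≢0 t≢0 lam≢0) (-≢0 y≢y′)

      1-y≢0 : u ≢ v → 1# - y ≢ 0#
      1-y≢0 u≢v p = F.*-≢0 (-≢0 u≢v) (-≢0 u≢v) (trans 1-y-discriminant
        (trans (cong (λ w → fromℕ 4 * fromℕ 4 * (lam * (lam * (w * (1# - y′))))) p)
          (solve 2 (λ l w → # 4 :* # 4 :* (l :* (l :* (# 0 :* w))) := # 0) refl lam (1# - y′))))

    private
      g : F → K
      g u = φ (t * (t + u))

      φ-≡0 : ∀ {x} → x ≡ 0# → φ x ≡ K.0#
      φ-≡0 refl = φ-0

      g-≡0 : ∀ {u} → t + u ≡ 0# → g u ≡ K.0#
      g-≡0 p = φ-≡0 (trans (cong (t *_) p) (F.zeroʳ t))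

    -- A double root leaves a single term on its own side and, through the vanishing discriminant,
    -- makes a φ-argument zero on the other side. So the surviving terms match in all four cases; if
    -- both roots are double, both sums are 0.
    sums-of-pairs : ∀ {y y′ u v} → FibrePair y y′ → RootPair c u v → FibreSum lam t ≡ RootSum g c
    sums-of-pairs {y} {y′} {u} {v} yy′ uv with y ≟ y′ | u ≟ v
    ... | no y≢y′ | no u≢v = trans (FibreSum-two yy′ y≢y′)
        (trans (cong₂ K._+_ (BP.transfer (BP.1-y≢0 u≢v) (BP.t+u≢0 y≢y′))
                            (BP′.transfer (BP′.1-y≢0 v≢u) (BP′.t+u≢0 y′≢y)))
               (sym (RootSum-two g uv u≢v)))
      where
      y′≢y = λ p → y≢y′ (sym p)
      v≢u = λ p → u≢v (sym p)
      module BP = BothPairs yy′ uv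
      module BP′ = BothPairs (swapFibre yy′) (swapRoots uv)
    ... | yes refl | no u≢v = trans (FibreSum-one yy′) (trans (split (*≡0 (BP.t+u-vanish refl)))
                                (sym (RootSum-two g uv u≢v)))
      where
      module BP = BothPairs yy′ uv
      module BP′ = BothPairs yy′ (swapRoots uv)
      distinct : ∀ {a b} → t + a ≡ 0# → t + b ≡ 0# → a ≡ b
      distinct {a} {b} p q = combine₂ 1# (- 1#) p q
        (solve 3 (λ t a b → a :- b := # 1 :* (t :+ a :- # 0) :+ (:- # 1) :* (t :+ b :- # 0)) refl t a b)
      split : t + u ≡ 0# ⊎ t + v ≡ 0# → φ (1# - y) ≡ g u K.+ g v
      split (inj₁ p) = trans (BP′.transfer (BP.1-y≢0 u≢v) (λ q → u≢v (distinct p q)))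
        (sym (trans (cong (K._+ g v) (g-≡0 p)) (K.+-identityˡ (g v))))
      split (inj₂ p) = trans (BP.transfer (BP.1-y≢0 u≢v) (λ q → u≢v (distinct q p)))
        (sym (trans (cong (K._+_ (g u)) (g-≡0 p)) (K.+-identityʳ (g u))))
    ... | no y≢y′ | yes refl = trans (FibreSum-two yy′ y≢y′) (trans (split (*≡0 (BP.1-y-vanish refl)))
                                (sym (RootSum-one g uv)))
      where
      module BP = BothPairs yy′ uv
      module BP′ = BothPairs (swapFibre yy′) uv
      distinct : ∀ {a b} → 1# - a ≡ 0# → 1# - b ≡ 0# → a ≡ b
      distinct {a} {b} p q = combine₂ (- 1#) 1# p q
        (solve 2 (λ a b → a :- b := (:- # 1) :* (# 1 :- a :- # 0) :+ # 1 :* (# 1 :- b :- # 0)) refl a b)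
      split : 1# - y ≡ 0# ⊎ 1# - y′ ≡ 0# → φ (1# - y) K.+ φ (1# - y′) ≡ g u
      split (inj₁ p) = trans (cong (K._+ φ (1# - y′)) (φ-≡0 p)) (trans (K.+-identityˡ _)
        (BP′.transfer (λ q → y≢y′ (distinct p q)) (BP.t+u≢0 y≢y′)))
      split (inj₂ p) = trans (cong (K._+_ (φ (1# - y))) (φ-≡0 p)) (trans (K.+-identityʳ _)
        (BP.transfer (λ q → y≢y′ (distinct q p)) (BP.t+u≢0 y≢y′)))
    ... | yes refl | yes refl = trans (FibreSum-one yy′) (trans
        (trans (φ-≡0 (square≡0 (BP.1-y-vanish refl))) (sym (g-≡0 (square≡0 (BP.t+u-vanish refl)))))
        (sym (RootSum-one g uv)))
      where
      module BP = BothPairs yy′ uv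

    FibreSum-no-root : ∀ {y y′} → FibrePair y y′ → (∀ u → ¬ Root c u) → FibreSum lam t ≡ K.0#
    FibreSum-no-root {y} {y′} yy′ ¬root = trans (FibreSum-two yy′ y≢y′) (φ-+≡0 ¬□)
      where
      ¬□ : ∀ z → ¬ z * z ≡ (1# - y) * (1# - y′)
      -- With (1 - y)(1 - y′) = z² the discriminant in u is (4λz)², and the quadratic formula gives
      -- u = 1 - 2λ ± 2λz.
      ¬□ z z² = ¬root (1# - fromℕ 2 * lam + fromℕ 2 * (lam * z)) (pairRoot {v = 1# - fromℕ 2 * lam - fromℕ 2 * (lam * z)}
        ( combine₂ (- (fromℕ 4 * (lam * lam))) (- (fromℕ 4 * lam)) z² (1-y-product yy′)
            (solve 3 (λ l z w → (# 1 :- # 2 :* l :+ # 2 :* (l :* z)) :* (# 1 :- # 2 :* l :- # 2 :* (l :* z)) :- # 1 :=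
               (:- (# 4 :* (l :* l))) :* (z :* z :- w) :+ (:- (# 4 :* l)) :* (l :* w :- (l :- # 1)))
               refl lam z ((1# - y) * (1# - y′)))
        , solve 2 (λ l z → # 1 :- # 2 :* l :+ # 2 :* (l :* z) :+ (# 1 :- # 2 :* l :- # 2 :* (l :* z)) :=
            # 2 :+ :- (# 4 :* l)) refl lam z))
      y≢y′ : y ≢ y′
      y≢y′ refl = ¬□ (1# - y) refl

    RootSum-no-fibre : ∀ {u v} → RootPair c u v → (∀ y → ¬ Fibre lam t y) → RootSum g c ≡ K.0#
    RootSum-no-fibre {u} {v} uv ¬fib = trans (RootSum-two g uv u≢v) (φ-+≡0 ¬□)
      where
      -- The denominator of the quadratic formula y = (1 + t ± e)/(2tλ), where e is a root of the
      -- discriminant.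
      m = (fromℕ 2 * (t * lam)) ⁻¹
      2tλ*m : fromℕ 2 * (t * lam) * m ≡ 1#
      2tλ*m = F.⁻¹-inverse _ (F.*-≢0 2≢0 (F.*-≢0 t≢0 lam≢0))
      ¬□D : ∀ e → ¬ e * e ≡ (1# + t) * (1# + t) - fromℕ 4 * (t * lam)
      ¬□D e e² = ¬fib ((1# + t + e) * m) (pairFibre {y′ = (1# + t - e) * m}
        ( combine₂ (- (t * lam * (m * m))) (fromℕ 2 * (t * lam) * m + 1#) e² 2tλ*m
            (solve 4 (λ t l e m → t :* l :* ((# 1 :+ t :+ e) :* m :* ((# 1 :+ t :- e) :* m)) :- # 1 :=
              (:- (t :* l :* (m :* m))) :* (e :* e :- ((# 1 :+ t) :* (# 1 :+ t) :- # 4 :* (t :* l)))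
              :+ (# 2 :* (t :* l) :* m :+ # 1) :* (# 2 :* (t :* l) :* m :- # 1)) refl t lam e m)
        , combine₁ (1# + t) 2tλ*m
            (solve 4 (λ t l e m → t :* l :* ((# 1 :+ t :+ e) :* m :+ (# 1 :+ t :- e) :* m) :- (# 1 :+ t) :=
              (# 1 :+ t) :* (# 2 :* (t :* l) :* m :- # 1)) refl t lam e m)))
      ¬□ : ∀ z → ¬ z * z ≡ t * (t + u) * (t * (t + v))
      -- Dividing z by t leaves a square root of (t + u)(t + v), which is the discriminant in y.
      ¬□ z z² = ¬□D (z * t ⁻¹) (trans (combine₂ (t ⁻¹ * t ⁻¹) ((t + u) * (t + v) * (t * t ⁻¹ + 1#)) z² (F.⁻¹-inverse t t≢0)
        (solve 5 (λ z i t u v → z :* i :* (z :* i) :- (t :+ u) :* (t :+ v) :=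
          i :* i :* (z :* z :- t :* (t :+ u) :* (t :* (t :+ v)))
          :+ (t :+ u) :* (t :+ v) :* (t :* i :+ # 1) :* (t :* i :- # 1)) refl z (t ⁻¹) t u v)) (t+u-product uv))
      u≢v : u ≢ v
      u≢v refl = ¬□ (t * (t + u)) refl

    FibreSum≡RootSum′ : FibreSum lam t ≡ RootSum g c
    FibreSum≡RootSum′ with exists? (Fibre? lam t) | exists? (Root? c)
    ... | inj₁ (y , fib) | inj₁ (u , root) = sums-of-pairs (fibrePair fib) (rootPair root)
    ... | inj₁ (y , fib) | inj₂ ¬root      = trans (FibreSum-no-root (fibrePair fib) ¬root) (sym (Σ-none (Root? c) g ¬root))
    ... | inj₂ ¬fib      | inj₁ (u , root) = trans (Σ-none (Fibre? lam t) _ ¬fib) (sym (RootSum-no-fibre (rootPair root) ¬fib))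
    ... | inj₂ ¬fib      | inj₂ ¬root      = trans (Σ-none (Fibre? lam t) _ ¬fib) (sym (Σ-none (Root? c) g ¬root))

  -- For λ = 0 the equation is linear, with y = 1/(1 + t) and 1 - y = t/(1 + t), which equals t (t +
  -- 1) up to a square. For t = -1 there is no solution, and t (t + 1) = 0.
  FibreSum-0 : ∀ {t} → t ≢ 0# → FibreSum 0# t ≡ φ (t * (t + 1#))
  FibreSum-0 {t} t≢0 = go ((1# + t) ≟ 0#)
    where
    go : Dec (1# + t ≡ 0#) → FibreSum 0# t ≡ φ (t * (t + 1#))
    go (yes p) = trans (Σ-none (Fibre? 0# t) _ ¬fib)
      (sym (trans (cong φ (trans (cong (t *_) (trans (F.+-comm t 1#) p)) (F.zeroʳ t))) φ-0))
      where
      ¬fib : ∀ y → ¬ Fibre 0# t y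
      ¬fib y fib = F.0≢1 (combine₂ 1# (- y) fib p
        (solve 2 (λ t y → # 0 :- # 1 := # 1 :* (t :* (y :* (# 1 :- # 0 :* y)) :- (# 1 :- y)) :+ (:- y) :* (# 1 :+ t :- # 0))
          refl t y))
    go (no 1+t≢0) = trans (Σ-one (Fibre? 0# t) _ fib only)
      (φ-≡ t (λ p → F.*-≢0 t≢0 (F.⁻¹-≢0 1+t≢0) (trans (sym 1-i) p))
        (F.*-≢0 t≢0 (λ p → 1+t≢0 (trans (F.+-comm 1# t) p)))
        (combine₂ (- (t * (t + 1#))) (- (t * t)) 1-i inv
          (solve 2 (λ t i → t :* t :- (# 1 :- i) :* (t :* (t :+ # 1)) :=
            (:- (t :* (t :+ # 1))) :* (# 1 :- i :- t :* i) :+ (:- (t :* t)) :* ((# 1 :+ t) :* i :- # 1)) refl t i)))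
      where
      i = (1# + t) ⁻¹
      inv : (1# + t) * i ≡ 1#
      inv = F.⁻¹-inverse (1# + t) 1+t≢0
      1-i : 1# - i ≡ t * i
      1-i = combine₁ (- 1#) inv (solve 2 (λ t i → # 1 :- i :- t :* i := (:- # 1) :* ((# 1 :+ t) :* i :- # 1)) refl t i)
      fib : Fibre 0# t i
      fib = combine₁ 1# inv
        (solve 2 (λ t y → t :* (y :* (# 1 :- # 0 :* y)) :- (# 1 :- y) := # 1 :* ((# 1 :+ t) :* y :- # 1)) refl t i)
      only : ∀ y → Fibre 0# t y → y ≡ i
      only y fib′ = combine₂ i (- y) fib′ inv
        (solve 3 (λ t y i → y :- i := i :* (t :* (y :* (# 1 :- # 0 :* y)) :- (# 1 :- y)) :+ (:- y) :* ((# 1 :+ t) :* i :- # 1))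
          refl t y i)

  FibreSum≡RootSum : ∀ lam {t} → t ≢ 0# → FibreSum lam t ≡ RootSum (λ u → φ (t * (t + u))) (- (fromℕ 4 * lam))
  FibreSum≡RootSum lam {t} t≢0 = go (lam ≟ 0#)
    where
    go : Dec (lam ≡ 0#) → FibreSum lam t ≡ RootSum (λ u → φ (t * (t + u))) (- (fromℕ 4 * lam))
    go (no lam≢0) = NonzeroParameters.FibreSum≡RootSum′ lam≢0 t≢0
    -- For c = 0 the only root is the double root u = 1.
    go (yes refl) = trans (FibreSum-0 t≢0) (sym (RootSum-one _
      (F.*-identityˡ 1# , solve 0 (# 1 :+ # 1 := # 2 :+ :- (# 4 :* # 0)) refl)))

-- Evaluation of the hypergeometric sum and nonvanishing of the Jacobi sum

module Evaluation (𝔽 : FiniteField) (𝕂 : CharZeroField)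
    (2≢0 : ¬ (FiniteField.fromℕ 𝔽 2 ≡ FiniteField.0# 𝔽)) where
  open QuadraticTransformation 𝔽 𝕂 2≢0 public
  open ≡-Reasoning
  open F using (_+_; _*_; _-_; -_; _⁻¹; 0#; 1#; fromℕ; _≢_; _≟_)

  -- The convention that the inverse of 0 is 0 makes inversion a bijection of all of F, as
  -- `Σ-reindex` requires.
  ⁻¹-involutive : ∀ x → x ⁻¹ ⁻¹ ≡ x
  ⁻¹-involutive x = go (x ≟ 0#)
    where
    go : Dec (x ≡ 0#) → x ⁻¹ ⁻¹ ≡ x
    go (yes refl) = trans (cong _⁻¹ F.0⁻¹≡0) F.0⁻¹≡0
    go (no x≢0)   = sym (F.⁻¹-unique (trans (F.*-comm (x ⁻¹) x) (F.⁻¹-inverse x x≢0)))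

  ε≡1-indicator : (f : F → K) → f 0# ≡ K.0# → (∀ k → k ≢ 0# → f k ≡ K.1#) →
                  ∀ k → f k ≡ K.1# K.- indicator (k ≟ 0#)
  ε≡1-indicator f f0 f1 k with k ≟ 0#
  ... | yes refl = trans f0 (sym (K.-‿inverseʳ K.1#))
  ... | no k≢0   = trans (f1 k k≢0) (sym (trans (cong (K._+_ K.1#) K.-0≡0) (K.+-identityʳ K.1#)))

  q : K
  q = ΣF (λ _ → K.1#)

  q≢0 : ¬ q ≡ K.0#
  q≢0 q≡0 = K.0≢1 (sym (Σ-0-or-c (λ p → K.0≢1 (sym p)) (λ _ → inj₂ refl) q≡0 0#))

  q≢q-1 : ¬ q ≡ q K.- K.1#
  q≢q-1 p = K.0≢1 (K.combine₁ (K.- K.1#) p (solve 1 (λ q → # 0 :- # 1 := (:- # 1) :* (q :- (q :- # 1))) refl q))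
    where open K

  Σ-indicator : ∀ a → ΣF (λ x → indicator (x ≟ a)) ≡ K.1#
  Σ-indicator a = trans (Σ-cong (λ x → sym (K.*-identityʳ _))) (Σ-point a (λ _ → K.1#))

  Σ-neg : ∀ f → ΣF (λ x → K.- f x) ≡ K.- ΣF f
  Σ-neg f = trans (Σ-cong (λ x → solve 1 (λ a → :- a := (:- # 1) :* a) refl (f x)))
    (trans (Σ-* (K.- K.1#) f) (solve 1 (λ a → (:- # 1) :* a := :- a) refl (ΣF f)))
    where open K

  Σ-ε : (f : F → K) → f 0# ≡ K.0# → (∀ k → k ≢ 0# → f k ≡ K.1#) → ΣF f ≡ q K.- K.1#
  Σ-ε f f0 f1 = trans (Σ-cong (ε≡1-indicator f f0 f1)) (trans (Σ-+ _ _)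
    (cong (K._+_ q) (trans (Σ-neg _) (cong K.-_ (Σ-indicator 0#)))))

  -- For u ≠ 0 the factor u² is removed from u (u + b), leaving φ(1 + b/u).
  Σφφ : ∀ b → b ≢ 0# → ΣF (λ u → φ (u + b) K.* φ u) ≡ K.- K.1#
  Σφφ b b≢0 = begin
    ΣF (λ u → φ (u + b) K.* φ u)                             ≡⟨ Σ-cong (λ u → term u (u ≟ 0#)) ⟩
    ΣF (λ u → φ (b * u ⁻¹ + 1#) K.- indicator (u ≟ 0#))      ≡⟨ Σ-+ _ _ ⟩
    ΣF (λ u → φ (b * u ⁻¹ + 1#)) K.+ ΣF (λ u → K.- indicator (u ≟ 0#))
      ≡⟨ cong₂ K._+_ Σφ-inv (trans (Σ-neg _) (cong K.-_ (Σ-indicator 0#))) ⟩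
    K.0# K.- K.1#                                            ≡⟨ K.+-identityˡ _ ⟩
    K.- K.1#                                                 ∎
    where
    Σφ-inv : ΣF (λ u → φ (b * u ⁻¹ + 1#)) ≡ K.0#
    Σφ-inv = trans (Σ-reindex _⁻¹ _⁻¹ ⁻¹-involutive ⁻¹-involutive (λ u → φ (b * u + 1#)))
      (trans (Σ-dilate b≢0 (λ u → φ (u + 1#))) (trans (Σ-translate 1# φ) Σφ≡0))
    term : ∀ u (d : Dec (u ≡ 0#)) → φ (u + b) K.* φ u ≡ φ (b * u ⁻¹ + 1#) K.- indicator d
    term u (yes refl) = trans (K.x*0≡0 φ-0) (sym (trans
      (cong (K._- K.1#) (trans (cong φ (trans (cong (λ i → b * i + 1#) F.0⁻¹≡0)
        (solve 1 (λ b → b :* # 0 :+ # 1 := # 1) refl b))) φ-1)) (K.-‿inverseʳ K.1#)))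
      where open F
    term u (no u≢0) = begin
      φ (u + b) K.* φ u                   ≡⟨ φ-* (u + b) u ⟨
      φ ((u + b) * u)                     ≡⟨ cong φ (combine₁ (- (u * b)) (F.⁻¹-inverse u u≢0)
                                               (solve 3 (λ u b i → (u :+ b) :* u :- (b :* i :+ # 1) :* (u :* u) :=
                                                 (:- (u :* b)) :* (u :* i :- # 1)) refl u b (u ⁻¹))) ⟩
      φ ((b * u ⁻¹ + 1#) * (u * u))       ≡⟨ φ-*-square u≢0 _ ⟩
      φ (b * u ⁻¹ + 1#)                   ≡⟨ trans (cong (K._+_ _) K.-0≡0) (K.+-identityʳ _) ⟨
      φ (b * u ⁻¹ + 1#) K.- K.0#          ∎
      where open F

  Σφφ-0 : ΣF (λ u → φ (u + 0#) K.* φ u) ≡ q K.- K.1#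
  Σφφ-0 = Σ-ε _ (K.x*0≡0 φ-0)
    (λ k k≢0 → trans (cong (λ j → φ j K.* φ k) (F.+-identityʳ k)) (φ*φ k≢0))

  -- The autocorrelation of φ. Its peak at t = 1 isolates a single term in `Σ-Twisted`.
  Σφφ-shifted : ∀ t → ΣF (λ u → φ (t + u) K.* φ (u + 1#)) ≡ indicator (t ≟ 1#) K.* q K.- K.1#
  Σφφ-shifted t = begin
    ΣF (λ u → φ (t + u) K.* φ (u + 1#))
      ≡⟨ Σ-cong (λ u → cong (λ k → φ k K.* φ (u + 1#))
           (solve 2 (λ t u → t :+ u := u :+ # 1 :+ (t :- # 1)) refl t u)) ⟩
    ΣF (λ u → φ (u + 1# + (t - 1#)) K.* φ (u + 1#))          ≡⟨ Σ-translate 1# (λ u → φ (u + (t - 1#)) K.* φ u) ⟩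
    ΣF (λ u → φ (u + (t - 1#)) K.* φ u)                      ≡⟨ value (t ≟ 1#) ⟩
    indicator (t ≟ 1#) K.* q K.- K.1#                        ∎
    where
    open F
    value : (d : Dec (t ≡ 1#)) → ΣF (λ u → φ (u + (t - 1#)) K.* φ u) ≡ indicator d K.* q K.- K.1#
    value (yes refl) = trans (cong (λ k → ΣF (λ u → φ (u + k) K.* φ u)) (-‿inverseʳ 1#))
      (trans Σφφ-0 (cong (K._- K.1#) (sym (K.*-identityˡ q))))
    value (no t≢1) = trans (Σφφ (t - 1#) (-≢0 t≢1))
      (sym (trans (cong (K._- K.1#) (K.zeroˡ q)) (K.+-identityˡ _)))

  Σ-character : (A : Character) → ∀ {k} → k ≢ 0# → χ A k K.* ΣF (χ A) ≡ ΣF (χ A)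
  Σ-character A {k} k≢0 = trans (sym (Σ-* (χ A k) (χ A)))
    (trans (Σ-cong (λ x → sym (χ-mul A k x))) (Σ-dilate k≢0 (χ A)))

  -- Multiplication by k permutes F, so the sum is fixed under multiplication by A(k); a nonzero sum
  -- can be cancelled.
  Σ≢0⇒trivial : (A : Character) → ¬ ΣF (χ A) ≡ K.0# → ∀ k → k ≢ 0# → χ A k ≡ K.1#
  Σ≢0⇒trivial A Σ≢0 k k≢0 = K.*-cancelˡ Σ≢0 (trans (K.*-comm _ _) (trans (Σ-character A k≢0) (sym (K.*-identityʳ _))))

  φ-twist : Character → Character
  φ-twist A = record
    { χ = χ A · φ
    ; χ-0 = K.0*y≡0 (χ-0 A)
    ; χ-1 = trans (cong₂ K._*_ (χ-1 A) φ-1) (K.*-identityˡ K.1#)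
    ; χ-mul = λ x y → trans (cong₂ K._*_ (χ-mul A x y) (φ-* x y))
        (K.solve 4 (λ a b c d → a K.:* b K.:* (c K.:* d) K.:= a K.:* c K.:* (b K.:* d)) refl
          (χ A x) (χ A y) (φ x) (φ y))
    }

  module _ (A : Character) where
    private
      X = χ A

    ₂P₁-term : ∀ lam y → bar X y K.* (bar (bar X) · φ) (1# - y) K.* bar X (1# - lam * y)
               ≡ X (y ⁻¹ * (1# - y) * (1# - lam * y) ⁻¹) K.* φ (1# - y)
    ₂P₁-term lam y = begin
      X i K.* (X (w ⁻¹ ⁻¹) K.* φ w) K.* X j   ≡⟨ cong (λ k → X i K.* (X k K.* φ w) K.* X j) (⁻¹-involutive w) ⟩
      X i K.* (X w K.* φ w) K.* X j           ≡⟨ solve 4 (λ i w p j → i :* (w :* p) :* j := i :* w :* j :* p) refl _ _ _ _ ⟩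
      X i K.* X w K.* X j K.* φ w             ≡⟨ cong (λ k → k K.* X j K.* φ w) (χ-mul A i w) ⟨
      X (i * w) K.* X j K.* φ w               ≡⟨ cong (K._* φ w) (χ-mul A (i * w) j) ⟨
      X (i * w * j) K.* φ w                   ∎
      where
      open K using (solve; _:=_; _:*_)
      i = y ⁻¹
      w = 1# - y
      j = (1# - lam * y) ⁻¹

    -- The conditions `t ≡ τ y` and `Fibre lam t y` can differ only at t = 0 or y = 1, where A(t) or
    -- φ(1 - y) vanishes.
    ₂P₁-fibres : ∀ lam → ₂P₁ X (bar X) φ lam ≡ ΣF (λ t → X t K.* FibreSum lam t)
    ₂P₁-fibres lam = trans (Σ-cong (₂P₁-term lam)) (trans (Σ-fibre τ (λ y t → X t K.* φ (1# - y)))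
      (Σ-cong λ t → trans (Σ-cong (λ y → trans (swapFactors (indicator (t ≟ τ y)) (X t) (φ (1# - y))) (term t y (t ≟ 0#) ((1# - y) ≟ 0#)))) (Σ-* (X t) _)))
      where
      open F using (solve; #_; _:=_; _:+_; _:*_; _:-_; :-_; combine₁; combine₂; combine₃)
      τ : F → F
      τ y = y ⁻¹ * (1# - y) * (1# - lam * y) ⁻¹
      swapFactors : ∀ a b c → a K.* (b K.* c) ≡ b K.* (a K.* c)
      swapFactors = K.solve 3 (λ a b c → a K.:* (b K.:* c) K.:= b K.:* (a K.:* c)) refl
      τ⇒fibre : ∀ t y → t ≢ 0# → t ≡ τ y → Fibre lam t y
      τ⇒fibre t y t≢0 t≡τ = combine₃ (y * s) ((1# - y) * (y * y ⁻¹)) (1# - y) t≡τ (F.⁻¹-inverse s s≢0) (F.⁻¹-inverse y y≢0)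
        (solve 5 (λ t y s i j → t :* (y :* s) :- (# 1 :- y) := y :* s :* (t :- i :* (# 1 :- y) :* j)
          :+ (# 1 :- y) :* (y :* i) :* (s :* j :- # 1) :+ (# 1 :- y) :* (y :* i :- # 1)) refl t y s (y ⁻¹) (s ⁻¹))
        where
        s = 1# - lam * y
        y≢0 : y ≢ 0#
        y≢0 refl = t≢0 (trans t≡τ (trans (cong (λ k → k * (1# - y) * s ⁻¹) F.0⁻¹≡0)
          (solve 2 (λ a b → # 0 :* a :* b := # 0) refl (1# - y) (s ⁻¹))))
        s≢0 : s ≢ 0#
        s≢0 p = t≢0 (trans t≡τ (trans (cong (y ⁻¹ * (1# - y) *_) (trans (cong _⁻¹ p) F.0⁻¹≡0)) (F.zeroʳ _)))
      fibre⇒τ : ∀ t y → 1# - y ≢ 0# → Fibre lam t y → t ≡ τ y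
      fibre⇒τ t y w≢0 fib = combine₃ (y ⁻¹ * s ⁻¹) (- (t * (y * y ⁻¹))) (- t) fib (F.⁻¹-inverse s s≢0) (F.⁻¹-inverse y y≢0)
        (solve 5 (λ t y s i j → t :- i :* (# 1 :- y) :* j := i :* j :* (t :* (y :* s) :- (# 1 :- y))
          :+ (:- (t :* (y :* i))) :* (s :* j :- # 1) :+ (:- t) :* (y :* i :- # 1)) refl t y s (y ⁻¹) (s ⁻¹))
        where
        s = 1# - lam * y
        y≢0 : y ≢ 0#
        y≢0 refl = F.0≢1 (combine₁ 1# fib
          (solve 2 (λ l t → # 0 :- # 1 := # 1 :* (t :* (# 0 :* (# 1 :- l :* # 0)) :- (# 1 :- # 0))) refl lam t))
        s≢0 : s ≢ 0#
        s≢0 p = w≢0 (trans (sym fib) (trans (cong (λ k → t * (y * k)) p)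
          (solve 2 (λ t y → t :* (y :* # 0) := # 0) refl t y)))
      term : ∀ t y → Dec (t ≡ 0#) → Dec (1# - y ≡ 0#) →
             X t K.* (indicator (t ≟ τ y) K.* φ (1# - y)) ≡ X t K.* (indicator (Fibre? lam t y) K.* φ (1# - y))
      term t y (yes refl) _ = trans (K.0*y≡0 (χ-0 A)) (sym (K.0*y≡0 (χ-0 A)))
      term t y (no t≢0) (yes p) = cong (X t K.*_)
        (trans (K.x*0≡0 φw) (sym (K.x*0≡0 φw)))
        where φw = trans (cong φ p) φ-0
      term t y (no t≢0) (no w≢0) = cong (λ k → X t K.* (k K.* φ (1# - y)))
        (indicator-cong (τ⇒fibre t y t≢0) (fibre⇒τ t y w≢0) (t ≟ τ y) (Fibre? lam t y))

    Twisted : F → K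
    Twisted u = ΣF (λ t → X t K.* φ (t * (t + u)))

    -- The substitution t = us pulls A(u) out of the character and the square u² out of φ.
    Twisted-dilate : ∀ {u} → u ≢ 0# → Twisted u ≡ X u K.* Twisted 1#
    Twisted-dilate {u} u≢0 = begin
      ΣF (λ t → X t K.* φ (t * (t + u)))                    ≡⟨ Σ-dilate u≢0 (λ t → X t K.* φ (t * (t + u))) ⟨
      ΣF (λ s → X (u * s) K.* φ (u * s * (u * s + u)))      ≡⟨ Σ-cong term ⟩
      ΣF (λ s → X u K.* (X s K.* φ (s * (s + 1#))))         ≡⟨ Σ-* (X u) _ ⟩
      X u K.* Twisted 1#                                    ∎
      where
      term : ∀ s → X (u * s) K.* φ (u * s * (u * s + u)) ≡ X u K.* (X s K.* φ (s * (s + 1#)))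
      term s = trans (cong₂ K._*_ (χ-mul A u s) (trans
        (cong φ (solve 2 (λ u s → u :* s :* (u :* s :+ u) := s :* (s :+ # 1) :* (u :* u)) refl u s))
        (φ-*-square u≢0 _))) (K.*-assoc _ _ _)
        where open F

    cong-at-≢0 : ∀ {f g : F → K} → (∀ t → t ≢ 0# → f t ≡ g t) → ΣF (λ t → X t K.* f t) ≡ ΣF (λ t → X t K.* g t)
    cong-at-≢0 {f} {g} f≡g = Σ-cong (λ t → go t (t ≟ 0#))
      where
      go : ∀ t → Dec (t ≡ 0#) → X t K.* f t ≡ X t K.* g t
      go t (yes refl) = trans (K.0*y≡0 (χ-0 A)) (sym (K.0*y≡0 (χ-0 A)))
      go t (no t≢0)   = cong (X t K.*_) (f≡g t t≢0)

    -- The Jacobi sum is ₂P₁ at λ = 0, where the last factor is A(1) = 1.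
    jacobi : J (bar X) (bar (bar X) · φ) ≡ Twisted 1#
    jacobi = begin
      J (bar X) (bar (bar X) · φ)              ≡⟨ Σ-cong (λ y → sym (K.x*1≡x (X[1-0y] y))) ⟩
      ₂P₁ X (bar X) φ 0#                       ≡⟨ ₂P₁-fibres 0# ⟩
      ΣF (λ t → X t K.* FibreSum 0# t)         ≡⟨ cong-at-≢0 (λ t → FibreSum-0) ⟩
      Twisted 1#                               ∎
      where
      open F
      X[1-0y] : ∀ y → X ((1# - 0# * y) ⁻¹) ≡ K.1#
      X[1-0y] y = trans (cong X (trans (cong _⁻¹ (solve 1 (λ y → # 1 :- # 0 :* y := # 1) refl y)) 1⁻¹≡1)) (χ-1 A)

    -- After the exchange of sums the inner sum is `Twisted u`. Every root u is invertible, so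
    -- `Twisted-dilate` extracts the same factor from each.
    ₂P₁-evaluation : ∀ lam → ₂P₁ X (bar X) φ lam ≡ Twisted 1# K.* RootSum X (- (fromℕ 4 * lam))
    ₂P₁-evaluation lam = begin
      ₂P₁ X (bar X) φ lam
        ≡⟨ ₂P₁-fibres lam ⟩
      ΣF (λ t → X t K.* FibreSum lam t)
        ≡⟨ cong-at-≢0 (λ t → FibreSum≡RootSum lam) ⟩
      ΣF (λ t → X t K.* RootSum (λ u → φ (t * (t + u))) c)
        ≡⟨ Σ-cong (λ t → trans (sym (Σ-* (X t) _)) (Σ-cong (λ u → swapFactors (X t) _ _))) ⟩
      ΣF (λ t → ΣF (λ u → indicator (Root? c u) K.* (X t K.* φ (t * (t + u)))))
        ≡⟨ Σ-swap _ ⟩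
      ΣF (λ u → ΣF (λ t → indicator (Root? c u) K.* (X t K.* φ (t * (t + u)))))
        ≡⟨ Σ-cong (λ u → trans (Σ-* (indicator (Root? c u)) _) (term u (Root? c u))) ⟩
      ΣF (λ u → Twisted 1# K.* (indicator (Root? c u) K.* X u))
        ≡⟨ Σ-* (Twisted 1#) _ ⟩
      Twisted 1# K.* RootSum X c ∎
      where
      c = - (fromℕ 4 * lam)
      swapFactors : ∀ a b c → a K.* (b K.* c) ≡ b K.* (a K.* c)
      swapFactors = K.solve 3 (λ a b c → a K.:* (b K.:* c) K.:= b K.:* (a K.:* c)) refl
      term : ∀ u (d : Dec (Root c u)) → indicator d K.* Twisted u ≡ Twisted 1# K.* (indicator d K.* X u)
      term u (yes root) = trans (cong (K.1# K.*_) (Twisted-dilate (F.x*y≡1⇒x≢0 (proj₁ (rootPair root)))))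
        (K.solve 2 (λ x h → K.# 1 K.:* (x K.:* h) K.:= h K.:* (K.# 1 K.:* x)) refl (X u) (Twisted 1#))
      term u (no _) = K.solve 3 (λ a h x → K.# 0 K.:* a K.:= h K.:* (K.# 0 K.:* x)) refl (Twisted u) (Twisted 1#) (X u)

    Twisted-0 : Twisted 0# ≡ ΣF X
    Twisted-0 = trans (cong-at-≢0 {g = λ _ → K.1#} (λ t t≢0 → φ-square t (F.*-≢0 t≢0 (t+0≢0 t≢0)) (cong (t *_) (sym (F.+-identityʳ t)))))
      (Σ-cong (λ t → K.*-identityʳ (X t)))
      where
      t+0≢0 : ∀ {t} → t ≢ 0# → t + 0# ≢ 0#
      t+0≢0 {t} t≢0 p = t≢0 (trans (sym (F.+-identityʳ t)) p)

    -- The weight φ(u + 1) turns the sum over u into an autocorrelation, whose peak leaves q A(1)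
    -- φ(1). Its comparison with the term at u = 0 drives `Twisted-1≢0`.
    Σ-Twisted : ΣF (λ u → Twisted u K.* φ (u + 1#)) ≡ q K.- ΣF (X · φ)
    Σ-Twisted = begin
      ΣF (λ u → Twisted u K.* φ (u + 1#))
        ≡⟨ Σ-cong (λ u → trans (K.*-comm _ _) (sym (Σ-* (φ (u + 1#)) _))) ⟩
      ΣF (λ u → ΣF (λ t → φ (u + 1#) K.* (X t K.* φ (t * (t + u)))))
        ≡⟨ Σ-swap _ ⟩
      ΣF (λ t → ΣF (λ u → φ (u + 1#) K.* (X t K.* φ (t * (t + u)))))
        ≡⟨ Σ-cong (λ t → trans (Σ-cong (λ u → trans
             (cong (λ k → φ (u + 1#) K.* (X t K.* k)) (φ-* t (t + u))) (regroup _ _ _ _))) (Σ-* (X t K.* φ t) _)) ⟩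
      ΣF (λ t → X t K.* φ t K.* ΣF (λ u → φ (t + u) K.* φ (u + 1#)))
        ≡⟨ Σ-cong (λ t → trans (cong (X t K.* φ t K.*_) (Σφφ-shifted t)) (distribute _ _ _)) ⟩
      ΣF (λ t → q K.* (indicator (t ≟ 1#) K.* (X t K.* φ t)) K.+ K.- (X t K.* φ t))
        ≡⟨ trans (Σ-+ _ _) (cong₂ K._+_ (trans (Σ-* q _) (cong (q K.*_) (Σ-point 1# _))) (Σ-neg _)) ⟩
      q K.* (X 1# K.* φ 1#) K.- ΣF (X · φ)
        ≡⟨ cong (λ k → q K.* k K.- ΣF (X · φ)) (trans (cong₂ K._*_ (χ-1 A) φ-1) (K.*-identityˡ K.1#)) ⟩
      q K.* K.1# K.- ΣF (X · φ)
        ≡⟨ cong (K._- ΣF (X · φ)) (K.*-identityʳ q) ⟩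
      q K.- ΣF (X · φ) ∎
      where
      open K using (solve; _:=_; _:*_; _:+_; _:-_; :-_; #_)
      regroup : ∀ a x b c → a K.* (x K.* (b K.* c)) ≡ x K.* b K.* (c K.* a)
      regroup = solve 4 (λ a x b c → a :* (x :* (b :* c)) := x :* b :* (c :* a)) refl
      distribute : ∀ x i q → x K.* (i K.* q K.- K.1#) ≡ q K.* (i K.* x) K.+ K.- x
      distribute = solve 3 (λ x i q → x :* (i :* q :- # 1) := q :* (i :* x) :+ :- x) refl

    -- If the Jacobi sum vanished, so would Twisted u for all u ≠ 0, whence ΣA = q - Σ(Aφ).  But by
    -- orthogonality each of the two sums is 0 or q - 1, and at most one of A, Aφ is trivial.
    Twisted-1≢0 : ¬ Twisted 1# ≡ K.0#
    Twisted-1≢0 T≡0 = ¬ΣX≢0 ΣX≢0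
      where
      open K using (solve; _:=_; _:+_; _:-_; :-_; _:*_; #_)
      ΣX≡q-ΣXφ : ΣF X ≡ q K.- ΣF (X · φ)
      ΣX≡q-ΣXφ = begin
        ΣF X                                    ≡⟨ K.*-identityʳ _ ⟨
        ΣF X K.* K.1#                           ≡⟨ cong₂ K._*_ Twisted-0 (trans (cong φ (F.+-identityˡ 1#)) φ-1) ⟨
        Twisted 0# K.* φ (0# + 1#)              ≡⟨ Σ-single (λ u → Twisted u K.* φ (u + 1#)) 0# vanish ⟨
        ΣF (λ u → Twisted u K.* φ (u + 1#))     ≡⟨ Σ-Twisted ⟩
        q K.- ΣF (X · φ)                        ∎
        where
        vanish : ∀ u → u ≢ 0# → Twisted u K.* φ (u + 1#) ≡ K.0#
        vanish u u≢0 = K.0*y≡0 (trans (Twisted-dilate u≢0)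
          (K.x*0≡0 T≡0))
      ¬ΣX≢0 : ¬ ¬ ΣF X ≡ K.0#
      ¬ΣX≢0 ΣX≢0 = q≢q-1 (trans (sym (trans (cong (λ z → q K.- z) ΣXφ≡0) (solve 1 (λ q → q :- # 0 := q) refl q)))
          (trans (sym ΣX≡q-ΣXφ) (Σ-ε X (χ-0 A) trivial)))
        where
        trivial = Σ≢0⇒trivial A ΣX≢0
        ΣXφ≡0 : ΣF (X · φ) ≡ K.0#
        ΣXφ≡0 = trans (Σ-cong (λ t → go t (t ≟ 0#))) Σφ≡0
          where
          go : ∀ t → Dec (t ≡ 0#) → X t K.* φ t ≡ φ t
          go t (yes refl) = trans (K.x*0≡0 φ-0) (sym φ-0)
          go t (no t≢0)   = K.1*y≡y (trivial t t≢0)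
      ΣX≢0 : ¬ ΣF X ≡ K.0#
      ΣX≢0 ΣX≡0 = q≢q-1 (trans (sym ΣXφ≡q) (Σ-ε (X · φ) (χ-0 (φ-twist A)) (Σ≢0⇒trivial (φ-twist A) ΣXφ≢0)))
        where
        ΣXφ≡q : ΣF (X · φ) ≡ q
        ΣXφ≡q = K.combine₂ K.1# (K.- K.1#) ΣX≡q-ΣXφ ΣX≡0
          (solve 3 (λ s t q → t :- q := # 1 :* (s :- (q :- t)) :+ (:- # 1) :* (s :- # 0)) refl (ΣF X) (ΣF (X · φ)) q)
        ΣXφ≢0 : ¬ ΣF (X · φ) ≡ K.0#
        ΣXφ≢0 p = q≢0 (trans (sym ΣXφ≡q) p)

    ₂F₁-evaluation : ∀ lam → ₂F₁ X (bar X) φ lam ≡ RootSum X (- (fromℕ 4 * lam))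
    ₂F₁-evaluation lam = begin
      ₂P₁ X (bar X) φ lam K.* (J (bar X) (bar (bar X) · φ)) K.⁻¹
        ≡⟨ cong₂ (λ p j → p K.* j K.⁻¹) (₂P₁-evaluation lam) jacobi ⟩
      h K.* s K.* h K.⁻¹
        ≡⟨ K.combine₁ s (K.⁻¹-inverse h Twisted-1≢0)
             (solve 3 (λ h s i → h :* s :* i :- s := s :* (h :* i :- # 1)) refl h s (h K.⁻¹)) ⟩
      s ∎
      where
      open K using (solve; _:=_; _:-_; _:*_; #_)
      h = Twisted 1#
      s = RootSum X (- (fromℕ 4 * lam))

-- The triple-angle substitution and the delta terms

module CubicTransformation (𝔽 : FiniteField) (𝕂 : CharZeroField)
    (2≢0 : ¬ (FiniteField.fromℕ 𝔽 2 ≡ FiniteField.0# 𝔽)) where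
  open Evaluation 𝔽 𝕂 2≢0 public
  open ≡-Reasoning
  open F using (_+_; _*_; _-_; -_; _⁻¹; 0#; 1#; fromℕ; _≢_; _≟_;
                solve; #_; _:=_; _:+_; _:*_; _:-_; :-_; combine₁; combine₂; combine₃)

  δ-0 : ∀ {y} → y ≡ 0# → δ y ≡ K.1#
  δ-0 {y} y≡0 with y ≟ 0#
  ... | yes _   = refl
  ... | no y≢0  = contradiction y≡0 y≢0

  δ-≢0 : ∀ {y} → y ≢ 0# → δ y ≡ K.0#
  δ-≢0 {y} y≢0 with y ≟ 0#
  ... | yes y≡0 = contradiction y≡0 y≢0
  ... | no _    = refl

  φ-*δ-vanish : ∀ {a y} → (y ≡ 0# → a ≡ 0#) → φ a K.* δ y ≡ K.0#
  φ-*δ-vanish {a} {y} y⇒a = go (y ≟ 0#)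
    where
    go : Dec (y ≡ 0#) → φ a K.* δ y ≡ K.0#
    go (yes y≡0) = trans (cong (K._* δ y) (trans (cong φ (y⇒a y≡0)) φ-0)) (K.zeroˡ _)
    go (no y≢0)  = trans (cong (φ a K.*_) (δ-≢0 y≢0)) (K.zeroʳ _)

  pairDiscriminant : ∀ {c u v} → RootPair c u v → (u - v) * (u - v) ≡ (fromℕ 2 + c) * (fromℕ 2 + c) - fromℕ 4
  pairDiscriminant {c} {u} {v} (uv , u+v) = combine₂ (- fromℕ 4) (u + v + (fromℕ 2 + c)) uv u+v
    (solve 3 (λ c u v → (u :- v) :* (u :- v) :- ((# 2 :+ c) :* (# 2 :+ c) :- # 4) :=
      (:- # 4) :* (u :* v :- # 1) :+ (u :+ v :+ (# 2 :+ c)) :* (u :+ v :- (# 2 :+ c))) refl c u v)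

  rootFromDiscriminant : ∀ {c} e → e * e ≡ (fromℕ 2 + c) * (fromℕ 2 + c) - fromℕ 4 → ∃ (Root c)
  -- The quadratic formula (2 + c ± e)/2.
  rootFromDiscriminant {c} e e² = (fromℕ 2 + c + e) * h , pairRoot {v = (fromℕ 2 + c - e) * h}
    ( combine₂ (- (h * h)) (fromℕ 2 * h + 1#) e² 2h
        (solve 3 (λ c e h → (# 2 :+ c :+ e) :* h :* ((# 2 :+ c :- e) :* h) :- # 1 :=
          (:- (h :* h)) :* (e :* e :- ((# 2 :+ c) :* (# 2 :+ c) :- # 4)) :+ (# 2 :* h :+ # 1) :* (# 2 :* h :- # 1))
          refl c e h)
    , combine₁ (fromℕ 2 + c) 2h
        (solve 3 (λ c e h → (# 2 :+ c :+ e) :* h :+ (# 2 :+ c :- e) :* h :- (# 2 :+ c) :=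
          (# 2 :+ c) :* (# 2 :* h :- # 1)) refl c e h) )
    where
    h = fromℕ 2 ⁻¹
    2h = F.⁻¹-inverse (fromℕ 2) 2≢0

  module _ (A : Character) (x : F) where
    private
      X : F → K
      X = χ A

      -- The values of -4λ for λ = 3x/4 and for λ = 27x(1 - x)²/4.
      a b : F
      a = - (fromℕ 3 * x)
      b = - (fromℕ 27 * x * ((1# - x) * (1# - x)))

      infix 10 _³
      _³ : F → F
      u ³ = u * (u * u)

      Δ₁ Δ₂ : K
      Δ₁ = φ (- fromℕ 3) K.* δ (x - 1#)
      Δ₂ = φ (- fromℕ 3) K.* X (- 1#) K.* δ (x - fromℕ 3 ⁻¹)

    cube-³ : ∀ u → X (u ³) ≡ cube X u
    cube-³ u = trans (χ-mul A u (u * u)) (cong (X u K.*_) (χ-mul A u u))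

    -- The triple-angle formula: u³ + v³ = (u + v)³ - 3(u + v) when uv = 1.
    cubePair : ∀ {u v} → RootPair a u v → RootPair b (u ³) (v ³)
    cubePair {u} {v} (uv , u+v) = combine₁ (u * v * (u * v) + u * v + 1#) uv
        (solve 2 (λ u v → u :* (u :* u) :* (v :* (v :* v)) :- # 1 :=
          (u :* v :* (u :* v) :+ u :* v :+ # 1) :* (u :* v :- # 1)) refl u v)
      , combine₂ (- (fromℕ 3 * (u + v))) ((u + v) * (u + v) + (u + v) * (fromℕ 2 + a) + (fromℕ 2 + a) * (fromℕ 2 + a) - fromℕ 3)
          uv u+v
          (solve 3 (λ u v x → u :* (u :* u) :+ v :* (v :* v) :- (# 2 :+ :- (# 27 :* x :* ((# 1 :- x) :* (# 1 :- x)))) :=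
            (:- (# 3 :* (u :+ v))) :* (u :* v :- # 1)
            :+ ((u :+ v) :* (u :+ v) :+ (u :+ v) :* (# 2 :+ :- (# 3 :* x))
                :+ (# 2 :+ :- (# 3 :* x)) :* (# 2 :+ :- (# 3 :* x)) :- # 3) :* (u :+ v :- (# 2 :+ :- (# 3 :* x))))
            refl u v x)

    Δ₁-vanish : (x ≡ 1# → fromℕ 3 ≡ 0#) → Δ₁ ≡ K.0#
    Δ₁-vanish h = φ-*δ-vanish (λ p → trans (cong -_ (h (F.x-y≡0⇒x≡y p))) F.-0≡0)

    -- Stated with 3x = 1 because in characteristic 3 the inverse of 3 is 0 by convention: the delta
    -- factor is then 1 at x = 0, and φ(-3) = 0 removes it.
    Δ₂-vanish : (fromℕ 3 * x ≡ 1# → fromℕ 3 ≡ 0#) → Δ₂ ≡ K.0#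
    Δ₂-vanish h = trans (K.solve 3 (λ a b c → a K.:* b K.:* c K.:= a K.:* c K.:* b) refl _ _ _)
      (trans (cong (K._* X (- 1#)) (φ-*δ-vanish (λ p → trans (cong -_ (3≡0 p (fromℕ 3 ≟ 0#))) F.-0≡0))) (K.zeroˡ _))
      where
      3≡0 : x - fromℕ 3 ⁻¹ ≡ 0# → Dec (fromℕ 3 ≡ 0#) → fromℕ 3 ≡ 0#
      3≡0 p (yes 3≡0) = 3≡0
      3≡0 p (no 3≢0)  = h (trans (cong (fromℕ 3 *_) (F.x-y≡0⇒x≡y p)) (F.⁻¹-inverse (fromℕ 3) 3≢0))

    x≡1/3 : fromℕ 3 * x ≡ 1# → x - fromℕ 3 ⁻¹ ≡ 0#
    x≡1/3 p = F.x≡y⇒x-y≡0 (F.⁻¹-unique p)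

    ¬x≡1∧3x≡1 : x ≡ 1# → ¬ fromℕ 3 * x ≡ 1#
    ¬x≡1∧3x≡1 refl p = 2≢0 (combine₁ 1# p (solve 0 (# 2 :- # 0 := # 1 :* (# 3 :* # 1 :- # 1)) refl))

    -- The origin of φ(-3): at x = 1 and at 3x = 1 the discriminant of the equation for u is -3, so
    -- φ(-3) decides whether u lies in F.
    discriminant-x≡1 : x ≡ 1# → (fromℕ 2 + a) * (fromℕ 2 + a) - fromℕ 4 ≡ - fromℕ 3
    discriminant-x≡1 refl = solve 0 ((# 2 :+ :- (# 3 :* # 1)) :* (# 2 :+ :- (# 3 :* # 1)) :- # 4 := :- # 3) refl

    discriminant-3x≡1 : fromℕ 3 * x ≡ 1# → (fromℕ 2 + a) * (fromℕ 2 + a) - fromℕ 4 ≡ - fromℕ 3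
    discriminant-3x≡1 p = trans (cong (λ k → (fromℕ 2 - k) * (fromℕ 2 - k) - fromℕ 4) p)
      (solve 0 ((# 2 :- # 1) :* (# 2 :- # 1) :- # 4 := :- # 3) refl)

    Claim : Set
    Claim = RootSum X b ≡ RootSum (cube X) a K.- Δ₁ K.- Δ₂

    assemble : ∀ {l r d₁ d₂} → RootSum X b ≡ l → RootSum (cube X) a ≡ r → Δ₁ ≡ d₁ → Δ₂ ≡ d₂ → l ≡ r K.- d₁ K.- d₂ → Claim
    assemble refl refl p q l≡ = trans l≡ (sym (cong₂ (λ d e → RootSum (cube X) a K.- d K.- e) p q))

    x-0-0 : ∀ k → k ≡ k K.- K.0# K.- K.0#
    x-0-0 = K.solve 1 (λ k → k K.:= k K.:- K.# 0 K.:- K.# 0) refl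

    -- Cubing the roots when the equation for u is solvable

    module RootOf-a {u v : F} (uv : RootPair a u v) where

      [u-v]² : (u - v) * (u - v) ≡ (fromℕ 2 + a) * (fromℕ 2 + a) - fromℕ 4
      [u-v]² = pairDiscriminant uv

      -- The cofactor u² + uv + v² is (u + v)² - 1, which equals 3(1 - x)(1 - 3x). Its zeros are
      -- where distinct roots can have equal cubes.
      u³-v³ : u ³ - v ³ ≡ (u - v) * ((fromℕ 2 + a) * (fromℕ 2 + a) - 1#)
      u³-v³ = combine₂ (- (u - v)) ((u - v) * (u + v + (fromℕ 2 + a))) (proj₁ uv) (proj₂ uv)
        (solve 3 (λ u v a → u :* (u :* u) :- v :* (v :* v) :- (u :- v) :* ((# 2 :+ a) :* (# 2 :+ a) :- # 1) :=
          (:- (u :- v)) :* (u :* v :- # 1) :+ (u :- v) :* (u :+ v :+ (# 2 :+ a)) :* (u :+ v :- (# 2 :+ a))) refl u v a)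

      -- The discriminant is 0, so x = 1 or 3x = 1 would give 3 = 0, and φ(-3) = 0 then removes the
      -- delta terms.
      equal : u ≡ v → Claim
      equal refl = assemble (RootSum-one X (cubePair uv)) (RootSum-one (cube X) uv)
        (Δ₁-vanish (λ p → 3≡0 (discriminant-x≡1 p))) (Δ₂-vanish (λ p → 3≡0 (discriminant-3x≡1 p)))
        (trans (cube-³ u) (x-0-0 _))
        where
        3≡0 : (fromℕ 2 + a) * (fromℕ 2 + a) - fromℕ 4 ≡ - fromℕ 3 → fromℕ 3 ≡ 0#
        3≡0 p = combine₁ 1# (trans [u-v]² p)
          (solve 1 (λ u → # 3 :- # 0 := # 1 :* ((u :- u) :* (u :- u) :- (:- # 3))) refl u)

      cubes-agree : (fromℕ 2 + a) * (fromℕ 2 + a) - fromℕ 4 ≡ - fromℕ 3 → u ³ ≡ v ³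
      cubes-agree p = combine₂ 1# (u - v) u³-v³ p
        (solve 4 (λ w₁ w₂ d s → w₁ :- w₂ := # 1 :* (w₁ :- w₂ :- d :* (s :* s :- # 1)) :+ d :* (s :* s :- # 4 :- :- # 3))
          refl (u ³) (v ³) (u - v) (fromℕ 2 + a))

      distinct : u ≢ v → u ³ ≢ v ³ → Claim
      distinct u≢v u³≢v³ = assemble (RootSum-two X (cubePair uv) u³≢v³) (RootSum-two (cube X) uv u≢v)
        (Δ₁-vanish (λ p → contradiction (cubes-agree (discriminant-x≡1 p)) u³≢v³))
        (Δ₂-vanish (λ p → contradiction (cubes-agree (discriminant-3x≡1 p)) u³≢v³))
        (trans (cong₂ K._+_ (cube-³ u) (cube-³ v)) (x-0-0 _))

      -- With s = 2 + a, the relation u² = su - 1 gives u³ = (s² - 1)u - s. The value is 1 at x = 1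
      -- and -1 at 3x = 1.
      cube-value : (fromℕ 2 + a) * (fromℕ 2 + a) - 1# ≡ 0# → u ³ ≡ - (fromℕ 2 + a)
      cube-value s²≡1 = combine₃ ((u + s) * u) (- (u + s)) u (proj₂ uv) (proj₁ uv) s²≡1
        (solve 3 (λ u v s → u :* (u :* u) :- (:- s) := (u :+ s) :* u :* (u :+ v :- s)
          :+ (:- (u :+ s)) :* (u :* v :- # 1) :+ u :* (s :* s :- # 1 :- # 0)) refl u v s)
        where s = fromℕ 2 + a

      -- The common cube counts once on the left and twice on the right. The surplus A(u³) is the
      -- delta term, with φ(-3) = 1 because u - v is a square root of -3.
      collapse : u ≢ v → u ³ ≡ v ³ → Claim
      collapse u≢v u³≡v³ = split (*≡0 factors)
        where
        s²≡1 : (fromℕ 2 + a) * (fromℕ 2 + a) - 1# ≡ 0#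
        s²≡1 = F.x*y≡0⇒y≡0 (-≢0 u≢v) (trans (sym u³-v³) (F.x≡y⇒x-y≡0 u³≡v³))
        factors : (1# - fromℕ 3 * x) * (fromℕ 3 * (1# - x)) ≡ 0#
        factors = trans (solve 1 (λ x → (# 1 :- # 3 :* x) :* (# 3 :* (# 1 :- x)) :=
          (# 2 :+ :- (# 3 :* x)) :* (# 2 :+ :- (# 3 :* x)) :- # 1) refl x) s²≡1
        -- In characteristic 3 one has a = 0, which would make the discriminant 0 and u = v.
        3≢0 : fromℕ 3 ≢ 0#
        3≢0 p = F.*-≢0 (-≢0 u≢v) (-≢0 u≢v) (trans [u-v]² (trans (cong (λ k → (fromℕ 2 - k * x) * (fromℕ 2 - k * x) - fromℕ 4) p)
          (solve 1 (λ x → (# 2 :- # 0 :* x) :* (# 2 :- # 0 :* x) :- # 4 := # 0) refl x)))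
        φ[-3]≡1 : (fromℕ 2 + a) * (fromℕ 2 + a) - fromℕ 4 ≡ - fromℕ 3 → φ (- fromℕ 3) ≡ K.1#
        φ[-3]≡1 p = φ-square (u - v) (λ q → 3≢0 (trans (sym (F.-‿involutive _)) (trans (cong -_ q) F.-0≡0))) (trans [u-v]² p)
        conclude : ∀ {d₁ d₂} → Δ₁ ≡ d₁ → Δ₂ ≡ d₂ → X (u ³) ≡ d₁ K.+ d₂ → Claim
        conclude {d₁} {d₂} p q k≡ = assemble
          (RootSum-one X (subst (RootPair b (u ³)) (sym u³≡v³) (cubePair uv)))
          (trans (RootSum-two (cube X) uv u≢v) (cong₂ K._+_ (sym (cube-³ u)) (trans (sym (cube-³ v)) (cong X (sym u³≡v³)))))
          p q (K.combine₁ (K.- K.1#) k≡ (K.solve 3 (λ k d₁ d₂ → k K.:- (k K.:+ k K.:- d₁ K.:- d₂) K.:=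
            (K.:- K.# 1) K.:* (k K.:- (d₁ K.:+ d₂))) refl (X (u ³)) d₁ d₂))
        split : 1# - fromℕ 3 * x ≡ 0# ⊎ fromℕ 3 * (1# - x) ≡ 0# → Claim
        split (inj₁ p) = conclude (Δ₁-vanish (λ q → contradiction 3x≡1 (¬x≡1∧3x≡1 q)))
            (trans (K.x*1≡x (δ-0 (x≡1/3 3x≡1))) (K.1*y≡y (φ[-3]≡1 (discriminant-3x≡1 3x≡1))))
            (trans (cong X (trans (cube-value s²≡1) (trans (cong (λ k → - (fromℕ 2 - k)) 3x≡1)
              (solve 0 (:- (# 2 :- # 1) := :- # 1) refl)))) (sym (K.+-identityˡ _)))
          where
          3x≡1 : fromℕ 3 * x ≡ 1#
          3x≡1 = sym (F.x-y≡0⇒x≡y p)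
        split (inj₂ p) = conclude (trans (K.x*1≡x (δ-0 (F.x≡y⇒x-y≡0 x≡1))) (φ[-3]≡1 (discriminant-x≡1 x≡1)))
            (Δ₂-vanish (λ q → contradiction q (¬x≡1∧3x≡1 x≡1)))
            (trans (cong X (trans (cube-value s²≡1) (trans (cong (λ k → - (fromℕ 2 - fromℕ 3 * k)) x≡1)
              (solve 0 (:- (# 2 :- # 3 :* # 1) := # 1) refl)))) (trans (χ-1 A) (sym (K.+-identityʳ _))))
          where
          x≡1 : x ≡ 1#
          x≡1 = sym (F.x-y≡0⇒x≡y (F.x*y≡0⇒y≡0 3≢0 p))

    -- The case without roots u, where only the delta terms remain on the right

    module NoRootOf-a (¬root : ∀ u → ¬ Root a u) where

      -- In characteristic 3 the value u = 1 would be a root, since a = 0.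
      3≢0 : fromℕ 3 ≢ 0#
      3≢0 p = ¬root 1# (pairRoot {v = 1#} (F.*-identityˡ 1# ,
        combine₁ x p (solve 1 (λ x → # 1 :+ # 1 :- (# 2 :+ :- (# 3 :* x)) := x :* (# 3 :- # 0)) refl x)))

      φ[-3]≡-1 : (fromℕ 2 + a) * (fromℕ 2 + a) - fromℕ 4 ≡ - fromℕ 3 → φ (- fromℕ 3) ≡ K.- K.1#
      φ[-3]≡-1 p = φ-nonsquare (λ e e² → let u , root = rootFromDiscriminant e (trans e² (sym p)) in ¬root u root)

      RootSum-a : RootSum (cube X) a ≡ K.0#
      RootSum-a = Σ-none (Root? a) (cube X) ¬root

      -- Here b = 0, so the left side consists of the double root 1, whose term A(1) = 1 is -φ(-3).
      at-1 : x ≡ 1# → Claim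
      at-1 x≡1 = assemble (trans (RootSum-one X pair) (χ-1 A)) RootSum-a
        (trans (K.x*1≡x (δ-0 (F.x≡y⇒x-y≡0 x≡1))) (φ[-3]≡-1 (discriminant-x≡1 x≡1)))
        (Δ₂-vanish (λ q → contradiction q (¬x≡1∧3x≡1 x≡1)))
        (K.solve 0 (K.# 1 K.:= K.# 0 K.:- (K.:- K.# 1) K.:- K.# 0) refl)
        where
        pair : RootPair b 1# 1#
        pair = F.*-identityˡ 1# , sym (trans (cong (λ k → fromℕ 2 - fromℕ 27 * k * ((1# - k) * (1# - k))) x≡1)
          (solve 0 (# 2 :- # 27 :* # 1 :* ((# 1 :- # 1) :* (# 1 :- # 1)) := # 1 :+ # 1) refl))

      at-1/3 : fromℕ 3 * x ≡ 1# → Claim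
      at-1/3 3x≡1 = assemble (RootSum-one X pair) RootSum-a
        (Δ₁-vanish (λ q → contradiction 3x≡1 (¬x≡1∧3x≡1 q)))
        (trans (K.x*1≡x (δ-0 (x≡1/3 3x≡1))) (cong (K._* X (- 1#)) (φ[-3]≡-1 (discriminant-3x≡1 3x≡1))))
        (K.solve 1 (λ k → k K.:= K.# 0 K.:- K.# 0 K.:- (K.:- K.# 1) K.:* k) refl _)
        where
        pair : RootPair b (- 1#) (- 1#)
        pair = solve 0 ((:- # 1) :* (:- # 1) := # 1) refl ,
          -- With s = 3x one has b + 4 = -(s - 1)(s² - 5s + 4), so s = 1 gives b = -4 and the double
          -- root -1.
          combine₁ (fromℕ 3 * x * (fromℕ 3 * x) - fromℕ 5 * (fromℕ 3 * x) + fromℕ 4) 3x≡1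
            (solve 1 (λ x → :- # 1 :+ (:- # 1) :- (# 2 :+ :- (# 27 :* x :* ((# 1 :- x) :* (# 1 :- x)))) :=
              (# 3 :* x :* (# 3 :* x) :- # 5 :* (# 3 :* x) :+ # 4) :* (# 3 :* x :- # 1)) refl x)

      -- The discriminants satisfy b(b + 4) = a(a + 4) m² with m = 3 (1 - x) (1 - 3x).
      ¬root-b : x ≢ 1# → fromℕ 3 * x ≢ 1# → ∀ w → ¬ Root b w
      ¬root-b x≢1 3x≢1 w root = let u , root′ = rootFromDiscriminant (d * m ⁻¹) square-class in ¬root u root′
        where
        d m : F
        d = w - w ⁻¹
        m = fromℕ 3 * (1# - x) * (1# - fromℕ 3 * x)
        m≢0 : m ≢ 0#
        m≢0 = F.*-≢0 (F.*-≢0 3≢0 (-≢0 (λ p → x≢1 (sym p)))) (-≢0 (λ p → 3x≢1 (sym p)))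
        square-class : d * m ⁻¹ * (d * m ⁻¹) ≡ (fromℕ 2 + a) * (fromℕ 2 + a) - fromℕ 4
        square-class = combine₂ (m ⁻¹ * m ⁻¹) (((fromℕ 2 + a) * (fromℕ 2 + a) - fromℕ 4) * (m * m ⁻¹ + 1#))
          (pairDiscriminant (rootPair root)) (F.⁻¹-inverse m m≢0)
          (solve 3 (λ x d k →
            let s = # 2 :+ :- (# 3 :* x)
                s′ = # 2 :+ :- (# 27 :* x :* ((# 1 :- x) :* (# 1 :- x)))
                m = # 3 :* (# 1 :- x) :* (# 1 :- # 3 :* x)
            in d :* k :* (d :* k) :- (s :* s :- # 4) :=
               k :* k :* (d :* d :- (s′ :* s′ :- # 4)) :+ (s :* s :- # 4) :* (m :* k :+ # 1) :* (m :* k :- # 1))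
            refl x d (m ⁻¹))

      claim : Claim
      claim = go (x ≟ 1#) ((fromℕ 3 * x) ≟ 1#)
        where
        go : Dec (x ≡ 1#) → Dec (fromℕ 3 * x ≡ 1#) → Claim
        go (yes x≡1) _          = at-1 x≡1
        go (no _)    (yes 3x≡1) = at-1/3 3x≡1
        go (no x≢1)  (no 3x≢1)  = assemble (Σ-none (Root? b) X (¬root-b x≢1 3x≢1)) RootSum-a
          (Δ₁-vanish (λ p → contradiction p x≢1)) (Δ₂-vanish (λ p → contradiction p 3x≢1)) (x-0-0 K.0#)

    RootSum-cubic : Claim
    RootSum-cubic = go (exists? (Root? a))
      where
      go : ∃ (Root a) ⊎ (∀ u → ¬ Root a u) → Claim
      go (inj₂ ¬root)      = NoRootOf-a.claim ¬root
      go (inj₁ (u , root)) = compare (u ≟ (u ⁻¹)) ((u ³) ≟ ((u ⁻¹) ³))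
        where
        module R = RootOf-a (rootPair root)
        compare : Dec (u ≡ u ⁻¹) → Dec (u ³ ≡ (u ⁻¹) ³) → Claim
        compare (yes u≡v) _           = R.equal u≡v
        compare (no u≢v)  (no u³≢v³)  = R.distinct u≢v u³≢v³
        compare (no u≢v)  (yes u³≡v³) = R.collapse u≢v u³≡v³

  cubeCharacter : Character → Character
  cubeCharacter A = record
    { χ = cube (χ A)
    ; χ-0 = K.0*y≡0 (χ-0 A)
    ; χ-1 = trans (K.1*y≡y (χ-1 A)) (trans (K.1*y≡y (χ-1 A)) (χ-1 A))
    ; χ-mul = λ x y → trans (cong (λ k → k K.* (k K.* k)) (χ-mul A x y))
        (K.solve 2 (λ a b → a K.:* b K.:* (a K.:* b K.:* (a K.:* b)) K.:=
          a K.:* (a K.:* a) K.:* (b K.:* (b K.:* b))) refl (χ A x) (χ A y))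
    }

  cancel-4 : ∀ p → - (fromℕ 4 * (p * fromℕ 4 ⁻¹)) ≡ - p
  cancel-4 p = combine₁ (- p) (F.⁻¹-inverse (fromℕ 4) 4≢0)
    (solve 2 (λ p i → :- (# 4 :* (p :* i)) :- (:- p) := (:- p) :* (# 4 :* i :- # 1)) refl p (fromℕ 4 ⁻¹))

theorem1p2 : (𝔽 : FiniteField) (𝕂 : CharZeroField)
    → let open FiniteFieldHypergeometric 𝔽 𝕂
          module F = FiniteField 𝔽
          module K = CharZeroField 𝕂
      in ¬ (F.fromℕ 2 ≡ F.0#)
      → (A : Character) (x : F)
      → ₂F₁ (χ A) (bar (χ A)) φ
            (F.fromℕ 27 F.* x F.* ((F.1# F.- x) F.* (F.1# F.- x)) F.* (F.fromℕ 4) F.⁻¹)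
        ≡ ₂F₁ (cube (χ A)) (bar (cube (χ A))) φ (F.fromℕ 3 F.* x F.* (F.fromℕ 4) F.⁻¹)
          K.- φ (F.- F.fromℕ 3) K.* δ (x F.- F.1#)
          K.- φ (F.- F.fromℕ 3) K.* χ A (F.- F.1#) K.* δ (x F.- (F.fromℕ 3) F.⁻¹)
theorem1p2 𝔽 𝕂 2≢0 A x = begin
    ₂F₁ X (bar X) φ (fromℕ 27 * x * ((1# - x) * (1# - x)) * fromℕ 4 ⁻¹)
      ≡⟨ trans (₂F₁-evaluation A _) (cong (RootSum X) (cancel-4 _)) ⟩
    RootSum X (- (fromℕ 27 * x * ((1# - x) * (1# - x))))
      ≡⟨ RootSum-cubic A x ⟩
    RootSum (cube X) (- (fromℕ 3 * x)) K.- Δ₁ K.- Δ₂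
      ≡⟨ cong (λ r → r K.- Δ₁ K.- Δ₂) (trans (₂F₁-evaluation (cubeCharacter A) _) (cong (RootSum (cube X)) (cancel-4 _))) ⟨
    ₂F₁ (cube X) (bar (cube X)) φ (fromℕ 3 * x * fromℕ 4 ⁻¹) K.- Δ₁ K.- Δ₂ ∎
  where
  open CubicTransformation 𝔽 𝕂 2≢0
  open F using (_*_; _-_; -_; _⁻¹; 1#; fromℕ)
  open ≡-Reasoning
  X = χ A
  Δ₁ = φ (- fromℕ 3) K.* δ (x - 1#)
  Δ₂ = φ (- fromℕ 3) K.* χ A (- 1#) K.* δ (x - fromℕ 3 ⁻¹)
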